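{- Let $p=3$, let $n\geq 2$ be an integer and $q\in U^{(1)}-U^{(2)}$. Let $z_0\in\mathbb{Z}_3$ be a modular fixed point of $[\iota_q]_{3^n}$ such that $v_0:=v(z_0(z_0-1))$ is the smallest nonzero value of $v(z(z-1))$ among all modular fixed points $z$ of $[\iota_q]_{3^n}$. Let $\tau=3^{n-v_0-1}$. (a) If $q\equiv 7\pmod 9$, the set of all modular fixed points of $[\iota_q]_{3^n}$ in $\mathbb{Z}_3$ is $$\begin{cases}(z_0+\tau\mathbb{Z}_3)\cup\tau\mathbb{Z}_3\cup(1+3^{n-1}\mathbb{Z}_3) & \text{if } v_0<\frac{n-1}{2},\\ 3^{\lfloor n/2\rfloor}\mathbb{Z}_3\cup(1+3^{n-1}\mathbb{Z}_3) & \text{if } v_0\geq\frac{n-1}{2}.\end{cases}$$ (b) If $q\equiv 4\pmod 9$, the set of all modular fixed points of $[\iota_q]_{3^n}$ in $\mathbb{Z}_3$ is $$\begin{cases}(z_0+\tau\mathbb{Z}_3)\cup(1+\tau\mathbb{Z}_3)\cup 3^{n-1}\mathbb{Z}_3 & \text{if } v_0<\frac{n-1}{2},\\ (1+3^{\lfloor n/2\rfloor}\mathbb{Z}_3)\cup 3^{n-1}\mathbb{Z}_3 & \text{if } v_0\geq\frac{n-1}{2}.\end{cases}$$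
   Context: $\mathbb{Z}_3$ is the ring of $3$-adic integers with additive valuation $v=v_3$, and $U^{(m)}=1+3^m\mathbb{Z}_3$. For $q\in U^{(1)}$, $\iota_q:\mathbb{Z}_3\to\mathbb{Z}_3$ is the unique continuous function with $\iota_q(k)=1+q+\cdots+q^{k-1}$ for all integers $k\ge 0$; thus $\iota_q(z)=(q^z-1)/(q-1)$ for $q\ne1$. $[\iota_q]_{3^n}$ is its reduction modulo $3^n$, and $z\in\mathbb{Z}_3$ is a modular fixed point of $[\iota_q]_{3^n}$ if $\iota_q(z)\equiv z\pmod{3^n}$. One always has $v_0\le n-1$. -}

module Defs where

open import Algebra.Bundles using (CommutativeRing)
open import Data.Fin.Base using (Fin; toℕ) renaming (zero to fzero; suc to fsuc)
open import Data.Integer.Base as ℤ using (ℤ; +_; 0ℤ; 1ℤ)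
open import Data.Integer.Divisibility.Signed as ℤ∣ using (divides)
open import Data.Integer.DivMod using (_%ℕ_; _/ℕ_; a≡a%ℕn+[a/ℕn]*n)
import Data.Integer.Properties as ℤₚ
open import Data.Integer.Tactic.RingSolver using (solve-∀)
open import Data.Nat.Base as ℕ using (ℕ; zero; suc; NonZero)
import Data.Nat.Divisibility as ℕ∣
import Data.Nat.Properties as ℕₚ
open import Data.Product.Base using (_×_; _,_; ∃; ∃-syntax; proj₁; proj₂)
open import Data.Sum.Base using (inj₁; inj₂)
open import Level using (0ℓ)
open import Relation.Binary.PropositionalEquality
  using (_≡_; _≢_; refl; sym; trans; cong; cong₂; subst; module ≡-Reasoning)
open import Relation.Unary using (Pred)

private
  infix 4 _∣ℤ_
  _∣ℤ_ : ℤ → ℤ → Set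
  _∣ℤ_ = ℤ∣._∣_

  ∣-by : ∀ {d a b} → a ≡ b → d ∣ℤ a → d ∣ℤ b
  ∣-by refl p = p

  d∣0 : ∀ d → d ∣ℤ 0ℤ
  d∣0 d = divides 0ℤ refl

-- The inverse limit of the rings ℤ/3ⁿ: the n-th approximation is any integer
-- representing the residue class mod 3ⁿ, so equality is the relation _≈₃_.
record ℤ₃ : Set where
  constructor mkℤ₃
  field
    approx : ℕ → ℤ
    compat : ∀ n → + (3 ℕ.^ n) ∣ℤ approx (suc n) ℤ.- approx n
open ℤ₃ public

infix 4 _≈₃_
record _≈₃_ (x y : ℤ₃) : Set where
  constructor mk≈
  field
    at : ∀ n → + (3 ℕ.^ n) ∣ℤ approx x n ℤ.- approx y n
open _≈₃_ public

⟨_⟩ : ℕ → ℤ₃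
⟨ k ⟩ = mkℤ₃ (λ _ → + k) (λ n → ∣-by (sym (ℤₚ.+-inverseʳ (+ k))) (d∣0 _))

private
  infixl 6 _+₃_
  infixl 7 _*₃_

  _+₃_ _*₃_ : ℤ₃ → ℤ₃ → ℤ₃
  -₃_ : ℤ₃ → ℤ₃

  +-diff : ∀ a b c d → (a ℤ.- b) ℤ.+ (c ℤ.- d) ≡ (a ℤ.+ c) ℤ.- (b ℤ.+ d)
  +-diff = solve-∀

  *-diff : ∀ a b c d → (a ℤ.- b) ℤ.* c ℤ.+ b ℤ.* (c ℤ.- d) ≡ (a ℤ.* c) ℤ.- (b ℤ.* d)
  *-diff = solve-∀

  neg-diff : ∀ a b → ℤ.- (a ℤ.- b) ≡ (ℤ.- a) ℤ.- (ℤ.- b)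
  neg-diff = solve-∀

  flip-diff : ∀ a b → ℤ.- (a ℤ.- b) ≡ b ℤ.- a
  flip-diff = solve-∀

  chain-diff : ∀ a b c → (a ℤ.- b) ℤ.+ (b ℤ.- c) ≡ a ℤ.- c
  chain-diff = solve-∀

  ∣-+-diff : ∀ {m} a b c d → m ∣ℤ a ℤ.- b → m ∣ℤ c ℤ.- d → m ∣ℤ (a ℤ.+ c) ℤ.- (b ℤ.+ d)
  ∣-+-diff a b c d p q = ∣-by (+-diff a b c d) (ℤ∣.∣m∣n⇒∣m+n p q)

  ∣-*-diff : ∀ {m} a b c d → m ∣ℤ a ℤ.- b → m ∣ℤ c ℤ.- d → m ∣ℤ (a ℤ.* c) ℤ.- (b ℤ.* d)
  ∣-*-diff a b c d p q =
    ∣-by (*-diff a b c d) (ℤ∣.∣m∣n⇒∣m+n (ℤ∣.∣m⇒∣m*n c p) (ℤ∣.∣n⇒∣m*n b q))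

  ∣-neg-diff : ∀ {m} a b → m ∣ℤ a ℤ.- b → m ∣ℤ (ℤ.- a) ℤ.- (ℤ.- b)
  ∣-neg-diff a b p = ∣-by (neg-diff a b) (ℤ∣.∣m⇒∣-m p)

  ∣-flip : ∀ {m} a b → m ∣ℤ a ℤ.- b → m ∣ℤ b ℤ.- a
  ∣-flip a b p = ∣-by (flip-diff a b) (ℤ∣.∣m⇒∣-m p)

  ∣-chain : ∀ {m} a b c → m ∣ℤ a ℤ.- b → m ∣ℤ b ℤ.- c → m ∣ℤ a ℤ.- c
  ∣-chain a b c p q = ∣-by (chain-diff a b c) (ℤ∣.∣m∣n⇒∣m+n p q)

  approx (x +₃ y) n = approx x n ℤ.+ approx y n
  compat (x +₃ y) n =
    ∣-+-diff (approx x (suc n)) (approx x n) (approx y (suc n)) (approx y n)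
      (compat x n) (compat y n)

  approx (x *₃ y) n = approx x n ℤ.* approx y n
  compat (x *₃ y) n =
    ∣-*-diff (approx x (suc n)) (approx x n) (approx y (suc n)) (approx y n)
      (compat x n) (compat y n)

  approx (-₃ x) n = ℤ.- approx x n
  compat (-₃ x) n = ∣-neg-diff (approx x (suc n)) (approx x n) (compat x n)

  ≡⇒≈ : ∀ {x y} → (∀ n → approx x n ≡ approx y n) → x ≈₃ y
  at (≡⇒≈ {x} {y} e) n =
    ∣-by (sym (trans (cong (ℤ._- approx y n) (e n)) (ℤₚ.+-inverseʳ (approx y n)))) (d∣0 _)

ℤ₃-commutativeRing : CommutativeRing 0ℓ 0ℓ
ℤ₃-commutativeRing = record
  { Carrier = ℤ₃
  ; _≈_ = _≈₃_
  ; _+_ = _+₃_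
  ; _*_ = _*₃_
  ; -_ = -₃_
  ; 0# = ⟨ 0 ⟩
  ; 1# = ⟨ 1 ⟩
  ; isCommutativeRing = record
    { isRing = record
      { +-isAbelianGroup = record
        { isGroup = record
          { isMonoid = record
            { isSemigroup = record
              { isMagma = record
                { isEquivalence = record
                  { refl = ≡⇒≈ (λ _ → refl)
                  ; sym = λ {x} {y} p → mk≈ λ n → ∣-flip (approx x n) (approx y n) (at p n)
                  ; trans = λ {x} {y} {z} p q → mk≈ λ n →
                      ∣-chain (approx x n) (approx y n) (approx z n) (at p n) (at q n)
                  }
                ; ∙-cong = λ {x} {y} {u} {v} p q → mk≈ λ n →
                    ∣-+-diff (approx x n) (approx y n) (approx u n) (approx v n)
                      (at p n) (at q n)
                }
              ; assoc = λ x y z → ≡⇒≈ λ n →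
                  ℤₚ.+-assoc (approx x n) (approx y n) (approx z n)
              }
            ; identity = (λ x → ≡⇒≈ λ n → ℤₚ.+-identityˡ (approx x n))
                       , (λ x → ≡⇒≈ λ n → ℤₚ.+-identityʳ (approx x n))
            }
          ; inverse = (λ x → ≡⇒≈ λ n → ℤₚ.+-inverseˡ (approx x n))
                    , (λ x → ≡⇒≈ λ n → ℤₚ.+-inverseʳ (approx x n))
          ; ⁻¹-cong = λ {x} {y} p → mk≈ λ n →
              ∣-neg-diff (approx x n) (approx y n) (at p n)
          }
        ; comm = λ x y → ≡⇒≈ λ n → ℤₚ.+-comm (approx x n) (approx y n)
        }
      ; *-cong = λ {x} {y} {u} {v} p q → mk≈ λ n →
          ∣-*-diff (approx x n) (approx y n) (approx u n) (approx v n)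
            (at p n) (at q n)
      ; *-assoc = λ x y z → ≡⇒≈ λ n → ℤₚ.*-assoc (approx x n) (approx y n) (approx z n)
      ; *-identity = (λ x → ≡⇒≈ λ n → ℤₚ.*-identityˡ (approx x n))
                   , (λ x → ≡⇒≈ λ n → ℤₚ.*-identityʳ (approx x n))
      ; distrib = (λ x y z → ≡⇒≈ λ n →
                    ℤₚ.*-distribˡ-+ (approx x n) (approx y n) (approx z n))
                , (λ x y z → ≡⇒≈ λ n →
                    ℤₚ.*-distribʳ-+ (approx x n) (approx y n) (approx z n))
      }
    ; *-comm = λ x y → ≡⇒≈ λ n → ℤₚ.*-comm (approx x n) (approx y n)
    }
  }

open CommutativeRing ℤ₃-commutativeRing public
  using (_≈_; _+_; _*_; -_; _-_; 0#; 1#)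
open import Algebra.Properties.Semiring.Exp
  (CommutativeRing.semiring ℤ₃-commutativeRing) public
  using (_^_)
open import Algebra.Properties.Semiring.Sum
  (CommutativeRing.semiring ℤ₃-commutativeRing) public
  using (sum)
open import Algebra.Properties.Semiring.Divisibility
  (CommutativeRing.semiring ℤ₃-commutativeRing) public
  using (_∣_; _∤_; _,_)

infix 4 _≋_[mod_]
_≋_[mod_] : ℤ₃ → ℤ₃ → ℕ → Set
x ≋ y [mod t ] = ⟨ t ⟩ ∣ x - y

infix 7 _·ℤ₃ _⊹_ℤ₃

_·ℤ₃ : ℕ → Pred ℤ₃ 0ℓ
(t ·ℤ₃) z = ∃[ w ] z ≈ ⟨ t ⟩ * w

-- The coset a + t ℤ₃.
_⊹_ℤ₃ : ℤ₃ → ℕ → Pred ℤ₃ 0ℓ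
(a ⊹ t ℤ₃) z = ∃[ w ] z ≈ a + ⟨ t ⟩ * w

U⁽_⁾ : ℕ → Pred ℤ₃ 0ℓ
U⁽ m ⁾ = 1# ⊹ (3 ℕ.^ m) ℤ₃

-- v(x) = m for a finite m; v(x) = ∞ is the case where no m qualifies.
HasValuation : ℤ₃ → ℕ → Set
HasValuation x m = ⟨ 3 ℕ.^ m ⟩ ∣ x × ⟨ 3 ℕ.^ suc m ⟩ ∤ x

Continuous : (ℤ₃ → ℤ₃) → Set
Continuous f = ∀ x n → ∃[ m ] (∀ y → y ≋ x [mod 3 ℕ.^ m ] → f y ≋ f x [mod 3 ℕ.^ n ])

geometricSum : ℤ₃ → ℕ → ℤ₃
geometricSum q k = sum {k} (λ i → q ^ toℕ i)

-- The defining property of ι_q; for q ∈ U⁽ 1 ⁾ exactly one function has it,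
-- by ι-exists and ι-unique below.
record IsIota (q : ℤ₃) (ι : ℤ₃ → ℤ₃) : Set where
  field
    continuous   : Continuous ι
    interpolates : ∀ k → ι ⟨ k ⟩ ≈ geometricSum q k

IsModularFixedPoint : (ℤ₃ → ℤ₃) → ℕ → Pred ℤ₃ 0ℓ
IsModularFixedPoint ι n z = ι z ≋ z [mod 3 ℕ.^ n ]

-- v₀ = v(z₀(z₀-1)) is the smallest nonzero value of v(z(z-1)) over the modular
-- fixed points z. Infinite values cannot affect the minimum: v(z(z-1)) = n - 1 at
-- the modular fixed point 1 + 3ⁿ⁻¹ (q ≡ 7 mod 9) or 3ⁿ⁻¹ (q ≡ 4 mod 9).
record IsMinimalFixedPoint (ι : ℤ₃ → ℤ₃) (n : ℕ) (z₀ : ℤ₃) (v₀ : ℕ) : Set where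
  field
    fixed     : IsModularFixedPoint ι n z₀
    valuation : HasValuation (z₀ * (z₀ - 1#)) v₀
    nonzero   : v₀ ≢ 0
    minimal   : ∀ z m → IsModularFixedPoint ι n z → HasValuation (z * (z - 1#)) m →
                m ≢ 0 → v₀ ℕ.≤ m

private
  3^ : ℕ → ℤ
  3^ n = + (3 ℕ.^ n)

  3^≢0 : ∀ n → NonZero (3 ℕ.^ n)
  3^≢0 n = ℕₚ.m^n≢0 3 n

  3^suc : ∀ n → 3^ (suc n) ≡ + 3 ℤ.* 3^ n
  3^suc n = ℤₚ.pos-* 3 (3 ℕ.^ n)

  3^-mono : ∀ {m n} → m ℕ.≤ n → 3^ m ∣ℤ 3^ n
  3^-mono {m} {n} m≤n = ℤ∣.∣ᵤ⇒∣ (subst (λ k → 3 ℕ.^ m ℕ∣.∣ 3 ℕ.^ k) (ℕₚ.m+[n∸m]≡n m≤n)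
    (subst (3 ℕ.^ m ℕ∣.∣_) (sym (ℕₚ.^-distribˡ-+-* 3 m (n ℕ.∸ m))) (ℕ∣.m∣m*n (3 ℕ.^ (n ℕ.∸ m)))))

  approx-down : ∀ x k n → 3^ n ∣ℤ approx x (k ℕ.+ n) ℤ.- approx x n
  approx-down x zero n = ∣-by (sym (ℤₚ.+-inverseʳ (approx x n))) (d∣0 _)
  approx-down x (suc k) n = ∣-chain (approx x (suc k ℕ.+ n)) (approx x (k ℕ.+ n)) (approx x n)
    (ℤ∣.∣-trans (3^-mono (ℕₚ.m≤n+m n k)) (compat x (k ℕ.+ n))) (approx-down x k n)

  ∣⇒∣approx : ∀ n x → ⟨ 3 ℕ.^ n ⟩ ∣ x → 3^ n ∣ℤ approx x n
  ∣⇒∣approx n x (w , p) = ∣-by (lem (approx w n ℤ.* 3^ n) (approx x n))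
    (ℤ∣.∣m∣n⇒∣m-n (ℤ∣.∣n⇒∣m*n (approx w n) ℤ∣.∣-refl) (at p n))
    where
    lem : ∀ a b → a ℤ.- (a ℤ.- b) ≡ b
    lem = solve-∀

  approx∣⇒∣ : ∀ n x → 3^ n ∣ℤ approx x n → ⟨ 3 ℕ.^ n ⟩ ∣ x
  approx∣⇒∣ n x p = w , mk≈ λ k →
      ∣-by (cong (ℤ._- approx x k) (ℤ∣._∣_.equality (dv k))) (wx k)
    where
    open ≡-Reasoning
    add-back : ∀ a b → (a ℤ.- b) ℤ.+ b ≡ a
    add-back = solve-∀
    dv : ∀ k → 3^ n ∣ℤ approx x (k ℕ.+ n)
    dv k = ∣-by (add-back (approx x (k ℕ.+ n)) (approx x n))
      (ℤ∣.∣m∣n⇒∣m+n (approx-down x k n) p)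
    u : ℕ → ℤ
    u k = ℤ∣.quotient (dv k)
    scaled : ∀ a b c → c ℤ.* (a ℤ.- b) ≡ a ℤ.* c ℤ.- b ℤ.* c
    scaled = solve-∀
    w : ℤ₃
    approx w = u
    compat w k = ℤ∣.*-cancelˡ-∣ (3^ n) {{3^≢0 n}} (subst (_∣ℤ 3^ n ℤ.* (u (suc k) ℤ.- u k)) e₁
      (∣-by e₂ (compat x (k ℕ.+ n))))
      where
      e₁ : 3^ (k ℕ.+ n) ≡ 3^ n ℤ.* 3^ k
      e₁ = begin
        3^ (k ℕ.+ n)               ≡⟨ cong 3^ (ℕₚ.+-comm k n) ⟩
        3^ (n ℕ.+ k)               ≡⟨ cong +_ (ℕₚ.^-distribˡ-+-* 3 n k) ⟩
        + (3 ℕ.^ n ℕ.* 3 ℕ.^ k)    ≡⟨ ℤₚ.pos-* (3 ℕ.^ n) (3 ℕ.^ k) ⟩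
        3^ n ℤ.* 3^ k              ∎
      e₂ : approx x (suc k ℕ.+ n) ℤ.- approx x (k ℕ.+ n) ≡ 3^ n ℤ.* (u (suc k) ℤ.- u k)
      e₂ = trans
        (cong₂ ℤ._-_ (ℤ∣._∣_.equality (dv (suc k))) (ℤ∣._∣_.equality (dv k)))
        (sym (scaled (u (suc k)) (u k) (3^ n)))
    wx : ∀ k → 3^ k ∣ℤ approx x (k ℕ.+ n) ℤ.- approx x k
    wx k = subst (λ j → 3^ k ∣ℤ approx x j ℤ.- approx x k) (ℕₚ.+-comm n k)
      (approx-down x n k)

  rep : ℤ₃ → ℕ → ℕ
  rep x n = _%ℕ_ (approx x n) (3 ℕ.^ n) {{3^≢0 n}}

  rep-≡ : ∀ x n → 3^ n ∣ℤ approx x n ℤ.- + rep x n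
  rep-≡ x n = divides (_/ℕ_ (approx x n) (3 ℕ.^ n) {{3^≢0 n}})
    (trans (cong (ℤ._- + rep x n) (a≡a%ℕn+[a/ℕn]*n (approx x n) (3 ℕ.^ n) {{3^≢0 n}}))
           (cancel (+ rep x n) _))
    where
    cancel : ∀ a b → (a ℤ.+ b) ℤ.- a ≡ b
    cancel = solve-∀

  rep-≋ : ∀ x {m n} → m ℕ.≤ n → ⟨ rep x n ⟩ ≋ x [mod 3 ℕ.^ m ]
  rep-≋ x {m} {n} m≤n = approx∣⇒∣ m _ (∣-chain (+ rep x n) (approx x n) (approx x m)
    (∣-flip (approx x n) (+ rep x n) (ℤ∣.∣-trans (3^-mono m≤n) (rep-≡ x n)))
    (subst (λ j → 3^ m ∣ℤ approx x j ℤ.- approx x m) (ℕₚ.m∸n+n≡m m≤n)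
      (approx-down x (n ℕ.∸ m) m)))

  geom : ℤ → ℕ → ℤ
  geom a zero    = 0ℤ
  geom a (suc k) = 1ℤ ℤ.+ a ℤ.* geom a k

  geom-cong : ∀ {d} a b k → d ∣ℤ a ℤ.- b → d ∣ℤ geom a k ℤ.- geom b k
  geom-cong a b zero    p = d∣0 _
  geom-cong a b (suc k) p = ∣-+-diff 1ℤ 1ℤ (a ℤ.* geom a k) (b ℤ.* geom b k) (d∣0 _)
    (∣-*-diff a b (geom a k) (geom b k) p (geom-cong a b k p))

  geom-+ : ∀ a j m → geom a (j ℕ.+ m) ≡ geom a j ℤ.+ a ℤ.^ j ℤ.* geom a m
  geom-+ a zero m = lem (geom a m)
    where
    lem : ∀ x → x ≡ 0ℤ ℤ.+ 1ℤ ℤ.* x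
    lem = solve-∀
  geom-+ a (suc j) m = trans (cong (λ t → 1ℤ ℤ.+ a ℤ.* t) (geom-+ a j m))
    (lem a (geom a j) (a ℤ.^ j) (geom a m))
    where
    lem : ∀ a x p y → 1ℤ ℤ.+ a ℤ.* (x ℤ.+ p ℤ.* y) ≡ (1ℤ ℤ.+ a ℤ.* x) ℤ.+ a ℤ.* p ℤ.* y
    lem = solve-∀

  module _ {a : ℤ} (a≡1 : + 3 ∣ℤ a ℤ.- 1ℤ) where

    pow≡1 : ∀ m → + 3 ∣ℤ a ℤ.^ m ℤ.- 1ℤ
    pow≡1 zero    = d∣0 _
    pow≡1 (suc m) = ∣-*-diff a 1ℤ (a ℤ.^ m) 1ℤ a≡1 (pow≡1 m)

    geom-triple : ∀ m → geom a (3 ℕ.* m) ≡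
      (+ 3 ℤ.+ (a ℤ.^ m ℤ.- 1ℤ) ℤ.* (a ℤ.^ m ℤ.+ + 2)) ℤ.* geom a m
    geom-triple m = begin
      geom a (m ℕ.+ (m ℕ.+ (m ℕ.+ 0)))
        ≡⟨ geom-+ a m (m ℕ.+ (m ℕ.+ 0)) ⟩
      G ℤ.+ P ℤ.* geom a (m ℕ.+ (m ℕ.+ 0))
        ≡⟨ cong (λ t → G ℤ.+ P ℤ.* t) (geom-+ a m (m ℕ.+ 0)) ⟩
      G ℤ.+ P ℤ.* (G ℤ.+ P ℤ.* geom a (m ℕ.+ 0))
        ≡⟨ cong (λ t → G ℤ.+ P ℤ.* (G ℤ.+ P ℤ.* geom a t)) (ℕₚ.+-identityʳ m) ⟩
      G ℤ.+ P ℤ.* (G ℤ.+ P ℤ.* G)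
        ≡⟨ lem G P ⟩
      (+ 3 ℤ.+ (P ℤ.- 1ℤ) ℤ.* (P ℤ.+ + 2)) ℤ.* G ∎
      where
      open ≡-Reasoning
      G = geom a m
      P = a ℤ.^ m
      lem : ∀ g p → g ℤ.+ p ℤ.* (g ℤ.+ p ℤ.* g) ≡
        (+ 3 ℤ.+ (p ℤ.- 1ℤ) ℤ.* (p ℤ.+ + 2)) ℤ.* g
      lem = solve-∀

    geom-3^ : ∀ n → 3^ n ∣ℤ geom a (3 ℕ.^ n)
    geom-3^ zero    = divides (geom a 1) (sym (ℤₚ.*-identityʳ (geom a 1)))
    geom-3^ (suc n) = subst (_∣ℤ geom a (3 ℕ.^ suc n)) (sym (3^suc n))
      (∣-by (sym (geom-triple (3 ℕ.^ n))) (ℤ∣.∣-trans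
        (ℤ∣.*-monoʳ-∣ (+ 3) (geom-3^ n))
        (ℤ∣.*-monoˡ-∣ (geom a (3 ℕ.^ n)) (ℤ∣.∣m∣n⇒∣m+n ℤ∣.∣-refl
          (ℤ∣.∣m⇒∣m*n (a ℤ.^ (3 ℕ.^ n) ℤ.+ + 2) (pow≡1 (3 ℕ.^ n)))))))

    geom-3^* : ∀ n t → 3^ n ∣ℤ geom a (t ℕ.* 3 ℕ.^ n)
    geom-3^* n zero    = d∣0 _
    geom-3^* n (suc t) = ∣-by (sym (geom-+ a (3 ℕ.^ n) (t ℕ.* 3 ℕ.^ n)))
      (ℤ∣.∣m∣n⇒∣m+n (geom-3^ n) (ℤ∣.∣n⇒∣m*n (a ℤ.^ (3 ℕ.^ n)) (geom-3^* n t)))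

    geom-mod-≤ : ∀ n k l → l ℕ.≤ k → 3^ n ∣ℤ + k ℤ.- + l → 3^ n ∣ℤ geom a k ℤ.- geom a l
    geom-mod-≤ n k l l≤k p
      with ℤ∣.∣⇒∣ᵤ (∣-by (trans (ℤₚ.m-n≡m⊖n k l) (ℤₚ.⊖-≥ l≤k)) p)
    ... | ℕ∣.divides t k∸l≡t3ⁿ =
      subst (λ j → 3^ n ∣ℤ geom a j ℤ.- geom a l)
        (trans (cong (l ℕ.+_) (sym k∸l≡t3ⁿ)) (ℕₚ.m+[n∸m]≡n l≤k))
        (∣-by (sym (trans (cong (ℤ._- geom a l) (geom-+ a l (t ℕ.* 3 ℕ.^ n)))
                          (cancel (geom a l) _)))
          (ℤ∣.∣n⇒∣m*n (a ℤ.^ l) (geom-3^* n t)))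
      where
      cancel : ∀ a b → (a ℤ.+ b) ℤ.- a ≡ b
      cancel = solve-∀

    geom-mod : ∀ n k l → 3^ n ∣ℤ + k ℤ.- + l → 3^ n ∣ℤ geom a k ℤ.- geom a l
    geom-mod n k l p with ℕₚ.≤-total l k
    ... | inj₁ l≤k = geom-mod-≤ n k l l≤k p
    ... | inj₂ k≤l = ∣-flip (geom a l) (geom a k)
      (geom-mod-≤ n l k k≤l (∣-flip (+ k) (+ l) p))

  approx-^ : ∀ x k n → approx (x ^ k) n ≡ approx x n ℤ.^ k
  approx-^ x zero    n = refl
  approx-^ x (suc k) n = cong (approx x n ℤ.*_) (approx-^ x k n)

  approx-geometricSum : ∀ q k n → approx (geometricSum q k) n ≡ geom (approx q n) k
  approx-geometricSum q k n = trans (go k (λ i → q ^ toℕ i) 1ℤ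
      (λ i → trans (approx-^ q (toℕ i) n) (sym (ℤₚ.*-identityˡ _))))
      (ℤₚ.*-identityˡ (geom (approx q n) k))
    where
    a = approx q n
    step : ∀ c g → c ℤ.* 1ℤ ℤ.+ c ℤ.* a ℤ.* g ≡ c ℤ.* (1ℤ ℤ.+ a ℤ.* g)
    step c g = lem a c g
      where
      lem : ∀ a c g → c ℤ.* 1ℤ ℤ.+ c ℤ.* a ℤ.* g ≡ c ℤ.* (1ℤ ℤ.+ a ℤ.* g)
      lem = solve-∀
    go : ∀ k (f : Fin k → ℤ₃) c → (∀ i → approx (f i) n ≡ c ℤ.* a ℤ.^ toℕ i) →
         approx (sum f) n ≡ c ℤ.* geom a k
    go zero    f c e = sym (ℤₚ.*-zeroʳ c)
    go (suc k) f c e = trans (cong₂ ℤ._+_ (e fzero)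
      (go k (λ i → f (fsuc i)) (c ℤ.* a)
        (λ i → trans (e (fsuc i)) (sym (ℤₚ.*-assoc c a _)))))
      (step c (geom a k))

  U⁽¹⁾⇒≡1 : ∀ {q} → U⁽ 1 ⁾ q → ∀ n → + 3 ∣ℤ approx q (suc n) ℤ.- 1ℤ
  U⁽¹⁾⇒≡1 {q} (w , p) n = ∣-by (lem (approx q (suc n)) (+ 3 ℤ.* approx w (suc n)))
    (ℤ∣.∣m∣n⇒∣m+n (ℤ∣.∣-trans (3^-mono {1} {suc n} (ℕ.s≤s ℕ.z≤n)) (at p (suc n)))
                  (ℤ∣.∣m⇒∣m*n (approx w (suc n)) ℤ∣.∣-refl))
    where
    lem : ∀ a b → (a ℤ.- (1ℤ ℤ.+ b)) ℤ.+ b ≡ a ℤ.- 1ℤ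
    lem = solve-∀

  3^0∣ : ∀ a → 3^ 0 ∣ℤ a
  3^0∣ a = divides a (sym (ℤₚ.*-identityʳ a))

  geom-modᵁ : ∀ {q} → U⁽ 1 ⁾ q → ∀ n k l → 3^ n ∣ℤ + k ℤ.- + l →
    3^ n ∣ℤ geom (approx q n) k ℤ.- geom (approx q n) l
  geom-modᵁ u zero    k l p = 3^0∣ _
  geom-modᵁ u (suc n) k l p = geom-mod (U⁽¹⁾⇒≡1 u n) (suc n) k l p

  iota : ∀ q → U⁽ 1 ⁾ q → ℤ₃ → ℤ₃
  approx (iota q u z) n = geom (approx q n) (rep z n)
  compat (iota q u z) n =
    ∣-chain (geom a′ (rep z (suc n))) (geom a′ (rep z n)) (geom (approx q n) (rep z n))
      (geom-mod (U⁽¹⁾⇒≡1 u n) n (rep z (suc n)) (rep z n)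
        (∣-chain (+ rep z (suc n)) (approx z (suc n)) (+ rep z n)
          (∣-flip (approx z (suc n)) (+ rep z (suc n))
            (ℤ∣.∣-trans (3^-mono (ℕₚ.n≤1+n n)) (rep-≡ z (suc n))))
          (∣-chain (approx z (suc n)) (approx z n) (+ rep z n) (compat z n) (rep-≡ z n))))
      (geom-cong a′ (approx q n) (rep z n) (compat q n))
    where a′ = approx q (suc n)

ι-exists : ∀ q → U⁽ 1 ⁾ q → ∃[ ι ] IsIota q ι
ι-exists q u = iota q u , record
  { continuous = λ x n → n , λ y p → approx∣⇒∣ n _
      (geom-modᵁ u n (rep y n) (rep x n)
        (∣-chain (+ rep y n) (approx y n) (+ rep x n)
          (∣-flip (approx y n) (+ rep y n) (rep-≡ y n))
          (∣-chain (approx y n) (approx x n) (+ rep x n) (∣⇒∣approx n _ p) (rep-≡ x n))))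
  ; interpolates = λ k → mk≈ λ n →
      ∣-by (cong (ℤ._-_ (geom (approx q n) (rep ⟨ k ⟩ n))) (sym (approx-geometricSum q k n)))
        (geom-modᵁ u n (rep ⟨ k ⟩ n) k (∣-flip (+ k) (+ rep ⟨ k ⟩ n) (rep-≡ ⟨ k ⟩ n)))
  }

ι-unique : ∀ {q f g} → IsIota q f → IsIota q g → ∀ x → f x ≈ g x
at (ι-unique {q} {f} {g} F G x) n =
  ∣-chain (approx (f x) n) (approx (f ⟨ k ⟩) n) (approx (g x) n)
    (∣-flip (approx (f ⟨ k ⟩) n) (approx (f x) n) (∣⇒∣approx n _
      (proj₂ cf ⟨ k ⟩ (rep-≋ x (ℕₚ.m≤m+n (proj₁ cf) (proj₁ cg))))))
    (∣-chain (approx (f ⟨ k ⟩) n) (approx (geometricSum q k) n) (approx (g x) n)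
      (at (F.interpolates k) n)
      (∣-chain (approx (geometricSum q k) n) (approx (g ⟨ k ⟩) n) (approx (g x) n)
        (∣-flip (approx (g ⟨ k ⟩) n) (approx (geometricSum q k) n) (at (G.interpolates k) n))
        (∣⇒∣approx n _
          (proj₂ cg ⟨ k ⟩ (rep-≋ x (ℕₚ.m≤n+m (proj₁ cg) (proj₁ cf)))))))
  where
  module F = IsIota F
  module G = IsIota G
  cf = F.continuous x n
  cg = G.continuous x n
  k = rep x (proj₁ cf ℕ.+ proj₁ cg)

{-# OPTIONS --safe #-}
module Submission where

-- Write q = 1 + 3u and t = q - 1. For a natural number k, ι(k) = Σᵢ C(k, i + 1) tⁱ. The factors 3ⁱ in tⁱ more than
-- absorb the powers of 3 in the factorials, so 2M (ι(z) - z) ≡ 3u z (z - 1) F(z) modulo 3ⁿ, where M ≡ 1 (mod 3)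
-- and F(z) = M (1 + u (z - 2)) + 3 E(z) with E(x) - E(y) divisible by x - y. Hence z is a modular fixed point iff
-- 3ⁿ⁻¹ divides z (z - 1) F(z), and F(x) - F(y) = (x - y) s with s ≡ u (mod 3).
-- If u ≡ 2 (mod 3), then F vanishes modulo 3 exactly where z does, and v(F(x) - F(y)) = v(x - y); so F behaves like
-- z ↦ z - z* for a zero z* ≡ 0 (mod 3), and everything follows by comparing v(z) with v(z - z*).
-- The case u ≡ 1 (mod 3) is reduced to this one by the reflection z ↦ 1 - z.

open import Algebra.Bundles using (CommutativeRing)
import Algebra.Properties.Semiring.Divisibility as SemiringDivisibility
import Algebra.Properties.Semiring.Exp as SemiringExp
import Algebra.Properties.Semiring.Sum as SemiringSum
import Algebra.Solver.Ring as RingSolver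
open import Algebra.Solver.Ring.AlmostCommutativeRing
  using (_-Raw-AlmostCommutative⟶_; fromCommutativeRing)
open import Data.Fin.Base using (toℕ) renaming (zero to fzero; suc to fsuc)
open import Data.Integer.Base as ℤ using (ℤ; +_; -[1+_])
open import Data.Integer.Divisibility.Signed as ℤ∣ using (divides) renaming (_∣_ to _∣ℤ_)
open import Data.Integer.DivMod using (_%ℕ_; _/ℕ_; a≡a%ℕn+[a/ℕn]*n; n%ℕd<d)
import Data.Integer.Properties as ℤₚ
import Data.Integer.Tactic.RingSolver as ℤSolver
open import Data.Maybe.Base as Maybe using (Maybe)
open import Data.Nat.Base as ℕ using (ℕ; zero; suc; _≤_; _<_; _≥_; _∸_; ⌊_/2⌋; z≤n; s≤s)
  renaming (_*_ to _*ℕ_; _^_ to _^ℕ_)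
import Data.Nat.Divisibility as ℕ∣
open import Data.Nat.DivMod using (_divMod_; result)
open import Data.Nat.Induction using (<-rec)
import Data.Nat.Properties as ℕₚ
import Data.Nat.Tactic.RingSolver as ℕSolver
open import Data.Product.Base using (_×_; ∃-syntax; proj₁; proj₂; _,_)
open import Data.Sum.Base as Sum using (_⊎_; inj₁; inj₂; [_,_]′)
open import Function.Base using (_∘_)
open import Level using (0ℓ)
open import Relation.Binary.PropositionalEquality as ≡ using (_≡_; _≢_)
open import Relation.Nullary using (contradiction)
open import Relation.Nullary.Decidable using (dec⇒maybe)
open import Relation.Unary using (Pred; _∈_; _∉_; _∪_; _≐_)

-- After division by t the leading term of ι(k) - k is C(k, 2) = k (k - 1) / 2. The next one, t C(k,
-- 3) = u k (k - 1) (k - 2) / 2, loses its factor 3 to the denominator 3! and is as large as the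
-- leading one; for p > 3 it would stay divisible by p. This is the origin of the part u (z - 2) of
-- F, and hence of its zeros modulo 3. From C(k, 4) on, v((4 + j)!) ≤ 1 + j leaves a factor 3 in
-- t^(2 + j) / (4 + j)!, which is the 3 in 3 E. Denominators are cleared, not inverted: the 2 comes
-- from 2! and 3!, and M collects what is prime to 3 in the later factorials, with signs chosen to
-- make each contribution ≡ 1 (mod 3). The series is truncated with an exact remainder, so M and E
-- depend on n. The zero z* is never constructed. The ring is not assumed complete, and an
-- approximate zero modulo 3ⁿ suffices. Valuations, too, are decided only up to a given bound,
-- because equality with 0 is not decidable.

module _ (R : CommutativeRing 0ℓ 0ℓ) (⟨_⟩ : ℕ → CommutativeRing.Carrier R) where
  open CommutativeRing R hiding (zero)
  open SemiringDivisibility semiring using (_∣_; _∤_)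

  integer : ℤ → Carrier
  integer (+ n)    = ⟨ n ⟩
  integer -[1+ n ] = - ⟨ suc n ⟩

  -- `residue` and `3∤1` make the quotient by 3 a field with three elements in which each nonzero
  -- class is its own inverse. Together with `3-cancelˡ` this allows factors prime to 3 to be
  -- cancelled although no inverses are postulated.
  record Is3AdicRing : Set where
    field
      +-homo    : ∀ a b → integer (a ℤ.+ b) ≈ integer a + integer b
      *-homo    : ∀ a b → integer (a ℤ.* b) ≈ integer a * integer b
      -‿homo    : ∀ a → integer (ℤ.- a) ≈ - integer a
      0-homo    : ⟨ 0 ⟩ ≈ 0#
      1-homo    : ⟨ 1 ⟩ ≈ 1#
      3-cancelˡ : ∀ x y → ⟨ 3 ⟩ * x ≈ ⟨ 3 ⟩ * y → x ≈ y
      3∤1       : ⟨ 3 ⟩ ∤ ⟨ 1 ⟩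
      residue   : ∀ x → ⟨ 3 ⟩ ∣ x ⊎ ⟨ 3 ⟩ ∣ x - ⟨ 1 ⟩ ⊎ ⟨ 3 ⟩ ∣ x + ⟨ 1 ⟩

-- Abstract in the ring: conversion checking on compound elements of ℤ₃ would unfold their compat proofs.
module 3-AdicTheory
  (R : CommutativeRing 0ℓ 0ℓ)
  (⟨_⟩ : ℕ → CommutativeRing.Carrier R)
  (is3AdicRing : Is3AdicRing R ⟨_⟩)
  where

  open CommutativeRing R hiding (zero)
    renaming (refl to ≈-refl; sym to ≈-sym; trans to ≈-trans; reflexive to ≈-reflexive)
  open SemiringDivisibility semiring
    using (_∣_; _∤_; _,_; ∣ʳ-trans; ∣ʳ-respʳ-≈; ∣ʳ-respˡ-≈; ∣ʳ-refl)
  open Is3AdicRing is3AdicRing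
  open import Relation.Binary.Reasoning.Setoid setoid
  open SemiringExp semiring using (_^_)
  open SemiringSum semiring using (sum; *-distribˡ-sum)

  -- Integer coefficients with decidable equality let the ring solver compute with the numerals
  -- `⟨ n ⟩`, which would otherwise be unrelated atoms.
  morphism : ℤ.+-*-rawRing -Raw-AlmostCommutative⟶ fromCommutativeRing R
  morphism = record
    { ⟦_⟧    = integer R ⟨_⟩
    ; +-homo = +-homo
    ; *-homo = *-homo
    ; -‿homo = -‿homo
    ; 0-homo = 0-homo
    ; 1-homo = 1-homo
    }

  open RingSolver ℤ.+-*-rawRing (fromCommutativeRing R) morphism
    (λ a b → Maybe.map (λ a≡b → ≈-reflexive (≡.cong (integer R ⟨_⟩) a≡b)) (dec⇒maybe (a ℤₚ.≟ b)))
    using (Polynomial; solve; _:=_; _:+_; _:*_; _:-_; :-_; con)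

  ⟪_⟫ : ∀ {m} → ℕ → Polynomial m
  ⟪ n ⟫ = con (+ n)

  3^ : ℕ → Carrier
  3^ n = ⟨ 3 ℕ.^ n ⟩

  -- Divisibility, residues modulo 3 and valuations

  ∣-combine : ∀ {d x y z} a b → z ≈ a * x + b * y → d ∣ x → d ∣ y → d ∣ z
  ∣-combine {d} {x} {y} {z} a b e (u , ud≈x) (w , wd≈y) = a * u + b * w , (begin
    (a * u + b * w) * d
      ≈⟨ solve 5 (λ a b u w d → (a :* u :+ b :* w) :* d := a :* (u :* d) :+ b :* (w :* d)) ≈-refl a b u w d ⟩
    a * (u * d) + b * (w * d)  ≈⟨ +-cong (*-congˡ ud≈x) (*-congˡ wd≈y) ⟩
    a * x + b * y              ≈⟨ ≈-sym e ⟩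
    z                          ∎)

  ∣-scale : ∀ {d x z} a → z ≈ a * x → d ∣ x → d ∣ z
  ∣-scale {d} {x} {z} a e (u , ud≈x) = a * u , ≈-trans (*-assoc a u d) (≈-trans (*-congˡ ud≈x) (≈-sym e))

  ∣-≡mod : ∀ {d x y} → d ∣ x → d ∣ y - x → d ∣ y
  ∣-≡mod {x = x} {y} = ∣-combine ⟨ 1 ⟩ ⟨ 1 ⟩
    (solve 2 (λ x y → y := ⟪ 1 ⟫ :* x :+ ⟪ 1 ⟫ :* (y :- x)) ≈-refl x y)

  ∣-* : ∀ {a b x y} → a ∣ x → b ∣ y → a * b ∣ x * y
  ∣-* {a} {b} (u , e) (w , f) = u * w ,
    ≈-trans (solve 4 (λ u w a b → u :* w :* (a :* b) := u :* a :* (w :* b)) ≈-refl u w a b) (*-cong e f)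

  ∣⇒multiple : ∀ {t z} → t ∣ z → ∃[ w ] z ≈ t * w
  ∣⇒multiple (w , e) = w , ≈-trans (≈-sym e) (*-comm _ _)

  multiple⇒∣ : ∀ {t z} → ∃[ w ] z ≈ t * w → t ∣ z
  multiple⇒∣ (w , e) = w , ≈-trans (*-comm _ _) (≈-sym e)

  ∣⇒coset : ∀ {a t z} → t ∣ z - a → ∃[ w ] z ≈ a + t * w
  ∣⇒coset {a} {t} {z} (w , e) = w , (begin
    z              ≈⟨ solve 2 (λ a z → z := a :+ (z :- a)) ≈-refl a z ⟩
    a + (z - a)    ≈⟨ +-congˡ (≈-trans (≈-sym e) (*-comm _ _)) ⟩
    a + t * w      ∎)

  coset⇒∣ : ∀ {a t z} → ∃[ w ] z ≈ a + t * w → t ∣ z - a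
  coset⇒∣ {a} {t} {z} (w , e) = w , (begin
    w * t          ≈⟨ solve 3 (λ a t w → w :* t := a :+ t :* w :- a) ≈-refl a t w ⟩
    a + t * w - a  ≈⟨ +-congʳ e ⟨
    z - a          ∎)

  Multiples : ℕ → Pred Carrier 0ℓ
  Multiples t z = ∃[ w ] z ≈ ⟨ t ⟩ * w

  Coset : Carrier → ℕ → Pred Carrier 0ℓ
  Coset a t z = ∃[ w ] z ≈ a + ⟨ t ⟩ * w

  ∣⇒coset₁ : ∀ {t z} → t ∣ z - ⟨ 1 ⟩ → ∃[ w ] z ≈ 1# + t * w
  ∣⇒coset₁ d = ∣⇒coset (∣ʳ-respʳ-≈ (+-congˡ (-‿cong 1-homo)) d)

  coset₁⇒∣ : ∀ {t z} → ∃[ w ] z ≈ 1# + t * w → t ∣ z - ⟨ 1 ⟩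
  coset₁⇒∣ c = ∣ʳ-respʳ-≈ (+-congˡ (-‿cong (≈-sym 1-homo))) (coset⇒∣ c)

  3^-+ : ∀ a b → 3^ (a ℕ.+ b) ≈ 3^ a * 3^ b
  3^-+ a b = ≈-trans
    (≈-reflexive (≡.cong (integer R ⟨_⟩) (≡.trans (≡.cong +_ (ℕₚ.^-distribˡ-+-* 3 a b)) (ℤₚ.pos-* (3 ℕ.^ a) (3 ℕ.^ b)))))
    (*-homo (+ (3 ℕ.^ a)) (+ (3 ℕ.^ b)))

  3^-suc : ∀ n → 3^ (suc n) ≈ ⟨ 3 ⟩ * 3^ n
  3^-suc n = 3^-+ 1 n

  3^0∣ : ∀ x → 3^ 0 ∣ x
  3^0∣ x = x , solve 1 (λ x → x :* ⟪ 1 ⟫ := x) ≈-refl x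

  3^-mono : ∀ {m n x} → m ≤ n → 3^ n ∣ x → 3^ m ∣ x
  3^-mono {m} {n} m≤n d = ∣ʳ-trans
    (3^ (n ∸ m) , ≈-trans (≈-sym (3^-+ (n ∸ m) m)) (≈-reflexive (≡.cong 3^ (ℕₚ.m∸n+n≡m m≤n)))) d

  3^-∣* : ∀ a b {x y} → 3^ a ∣ x → 3^ b ∣ y → 3^ (a ℕ.+ b) ∣ x * y
  3^-∣* a b p q = ∣ʳ-respˡ-≈ (≈-sym (3^-+ a b)) (∣-* p q)

  3∤⇒±1 : ∀ {x} → ⟨ 3 ⟩ ∤ x → ⟨ 3 ⟩ ∣ x - ⟨ 1 ⟩ ⊎ ⟨ 3 ⟩ ∣ x + ⟨ 1 ⟩
  3∤⇒±1 {x} 3∤x with residue x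
  ... | inj₁ 3∣x = contradiction 3∣x 3∤x
  ... | inj₂ r   = r

  -- Since x ≡ ±1 (mod 3), y is ±x y up to a multiple of 3.
  3∤-*-cancel : ∀ {x} y → ⟨ 3 ⟩ ∤ x → ⟨ 3 ⟩ ∣ x * y → ⟨ 3 ⟩ ∣ y
  3∤-*-cancel {x} y 3∤x d with 3∤⇒±1 3∤x
  ... | inj₁ r = ∣-combine ⟨ 1 ⟩ (- y)
    (solve 2 (λ x y → y := ⟪ 1 ⟫ :* (x :* y) :+ :- y :* (x :- ⟪ 1 ⟫)) ≈-refl x y) d r
  ... | inj₂ r = ∣-combine (- ⟨ 1 ⟩) y
    (solve 2 (λ x y → y := :- ⟪ 1 ⟫ :* (x :* y) :+ y :* (x :+ ⟪ 1 ⟫)) ≈-refl x y) d r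

  3∤-* : ∀ {x y} → ⟨ 3 ⟩ ∤ x → ⟨ 3 ⟩ ∤ y → ⟨ 3 ⟩ ∤ x * y
  3∤-* {y = y} 3∤x 3∤y d = 3∤y (3∤-*-cancel y 3∤x d)

  3^-cancelˡ : ∀ j k x → 3^ (j ℕ.+ k) ∣ 3^ j * x → 3^ k ∣ x
  3^-cancelˡ zero    k x d = ∣-scale ⟨ 1 ⟩ (solve 1 (λ x → x := ⟪ 1 ⟫ :* (⟪ 1 ⟫ :* x)) ≈-refl x) d
  3^-cancelˡ (suc j) k x (w , e) = 3^-cancelˡ j k x (w , 3-cancelˡ _ _ (begin
    ⟨ 3 ⟩ * (w * 3^ (j ℕ.+ k))  ≈⟨ solve 3 (λ a b c → a :* (b :* c) := b :* (a :* c)) ≈-refl _ _ _ ⟩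
    w * (⟨ 3 ⟩ * 3^ (j ℕ.+ k))  ≈⟨ *-congˡ (3^-suc (j ℕ.+ k)) ⟨
    w * 3^ (suc j ℕ.+ k)        ≈⟨ e ⟩
    3^ (suc j) * x              ≈⟨ *-congʳ (3^-suc j) ⟩
    ⟨ 3 ⟩ * 3^ j * x            ≈⟨ *-assoc _ _ _ ⟩
    ⟨ 3 ⟩ * (3^ j * x)          ∎))

  -- x is known to be invertible only modulo 3, so one factor 3 of y is split off at a time.
  3∤-cancelˡ : ∀ k {x} y → ⟨ 3 ⟩ ∤ x → 3^ k ∣ x * y → 3^ k ∣ y
  3∤-cancelˡ zero    {x} y 3∤x d = 3^0∣ y
  3∤-cancelˡ (suc k) {x} y 3∤x d with 3∤-*-cancel y 3∤x (3^-mono {1} {suc k} (s≤s z≤n) d)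
  ... | y′ , y′3≈y = ∣-scale ⟨ 1 ⟩
    (≈-trans (≈-sym y′3≈y) (solve 1 (λ y → y :* ⟪ 3 ⟫ := ⟪ 1 ⟫ :* (⟪ 3 ⟫ :* y)) ≈-refl y′))
    (3^-∣* 1 k {⟨ 3 ⟩} ∣ʳ-refl (3∤-cancelˡ k y′ 3∤x (3^-cancelˡ 1 k (x * y′) (∣ʳ-respʳ-≈ (begin
      x * y             ≈⟨ *-congˡ y′3≈y ⟨
      x * (y′ * ⟨ 3 ⟩)  ≈⟨ solve 2 (λ x y → x :* (y :* ⟪ 3 ⟫) := ⟪ 3 ⟫ :* (x :* y)) ≈-refl x y′ ⟩
      ⟨ 3 ⟩ * (x * y′)  ∎) d))))

  3∤-cancelʳ : ∀ k {x} y → ⟨ 3 ⟩ ∤ y → 3^ k ∣ x * y → 3^ k ∣ x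
  3∤-cancelʳ k {x} y 3∤y d = 3∤-cancelˡ k x 3∤y (∣ʳ-respʳ-≈ (*-comm x y) d)

  HasVal : Carrier → ℕ → Set
  HasVal x m = 3^ m ∣ x × 3^ (suc m) ∤ x

  3∣? : ∀ x → ⟨ 3 ⟩ ∣ x ⊎ ⟨ 3 ⟩ ∤ x
  3∣? x with residue x
  ... | inj₁ r        = inj₁ r
  ... | inj₂ (inj₁ r) = inj₂ λ d → 3∤1 (∣-combine ⟨ 1 ⟩ (- ⟨ 1 ⟩)
    (solve 1 (λ x → ⟪ 1 ⟫ := ⟪ 1 ⟫ :* x :+ :- ⟪ 1 ⟫ :* (x :- ⟪ 1 ⟫)) ≈-refl x) d r)
  ... | inj₂ (inj₂ r) = inj₂ λ d → 3∤1 (∣-combine (- ⟨ 1 ⟩) ⟨ 1 ⟩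
    (solve 1 (λ x → ⟪ 1 ⟫ := :- ⟪ 1 ⟫ :* x :+ ⟪ 1 ⟫ :* (x :+ ⟪ 1 ⟫)) ≈-refl x) d r)

  -- The bound m makes the valuation decidable: only finitely many divisions by 3 are tried, and x =
  -- 0 needs no separate test.
  3^∣⊎HasVal : ∀ m x → 3^ m ∣ x ⊎ (∃[ j ] j < m × HasVal x j)
  3^∣⊎HasVal zero    x = inj₁ (3^0∣ x)
  3^∣⊎HasVal (suc m) x with 3^∣⊎HasVal m x
  ... | inj₂ (j , j<m , v) = inj₂ (j , ℕₚ.m<n⇒m<1+n j<m , v)
  ... | inj₁ (y , e) with 3∣? y
  ...   | inj₁ 3∣y = inj₁ (∣ʳ-respʳ-≈ e (3^-∣* 1 m 3∣y ∣ʳ-refl))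
  ...   | inj₂ 3∤y = inj₂ (m , ℕₚ.n<1+n m , (y , e) , λ d → 3∤y
    (3^-cancelˡ m 1 y (3^-mono (ℕₚ.≤-reflexive (ℕₚ.+-comm m 1)) (∣ʳ-respʳ-≈ (≈-trans (≈-sym e) (*-comm _ _)) d))))

  HasVal-cancelˡ : ∀ j k {x} y → HasVal x j → 3^ (j ℕ.+ k) ∣ x * y → 3^ k ∣ y
  HasVal-cancelˡ j k {x} y ((u , e) , 3∤) d = 3∤-cancelˡ k y
    (λ 3∣u → 3∤ (∣ʳ-respʳ-≈ e (3^-∣* 1 j 3∣u ∣ʳ-refl)))
    (3^-cancelˡ j k (u * y) (∣ʳ-respʳ-≈ (≈-trans (*-congʳ (≈-sym e))
      (solve 3 (λ u p y → u :* p :* y := p :* (u :* y)) ≈-refl u (3^ j) y)) d))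

  HasVal-≥ : ∀ j {x m} → HasVal x j → 3^ m ∣ x → m ≤ j
  HasVal-≥ j (_ , ∤x) d = ℕₚ.≮⇒≥ λ j<m → ∤x (3^-mono j<m d)

  HasVal-*-unit : ∀ j {x e} → HasVal x j → ⟨ 3 ⟩ ∤ e → HasVal (x * e) j
  HasVal-*-unit j {x} {e} (d , ∤x) 3∤e =
    ∣-scale e (*-comm x e) d , λ d′ → ∤x (3∤-cancelʳ (suc j) e 3∤e d′)

  HasVal-cancel-unit : ∀ j {x e} → HasVal (x * e) j → ⟨ 3 ⟩ ∤ e → HasVal x j
  HasVal-cancel-unit j {x} {e} (d , ∤xe) 3∤e =
    3∤-cancelʳ j e 3∤e d , λ d′ → ∤xe (∣-scale e (*-comm x e) d′)

  HasVal-≈mod : ∀ j {x y} → HasVal x j → 3^ (suc j) ∣ x - y → HasVal y j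
  HasVal-≈mod j {x} {y} (d , ∤x) δ =
    ∣-combine ⟨ 1 ⟩ (- ⟨ 1 ⟩)
      (solve 2 (λ x y → y := ⟪ 1 ⟫ :* x :+ :- ⟪ 1 ⟫ :* (x :- y)) ≈-refl x y) d (3^-mono (ℕₚ.n≤1+n j) δ) ,
    λ d′ → ∤x (∣-combine ⟨ 1 ⟩ ⟨ 1 ⟩
      (solve 2 (λ x y → x := ⟪ 1 ⟫ :* y :+ ⟪ 1 ⟫ :* (x :- y)) ≈-refl x y) d′ δ)

  ≡0⇒3∤-1 : ∀ {z} → ⟨ 3 ⟩ ∣ z → ⟨ 3 ⟩ ∤ z - ⟨ 1 ⟩
  ≡0⇒3∤-1 {z} d d′ = 3∤1 (∣-combine ⟨ 1 ⟩ (- ⟨ 1 ⟩)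
    (solve 1 (λ x → ⟪ 1 ⟫ := ⟪ 1 ⟫ :* x :+ :- ⟪ 1 ⟫ :* (x :- ⟪ 1 ⟫)) ≈-refl z) d d′)

  ≡1⇒3∤ : ∀ {z} → ⟨ 3 ⟩ ∣ z - ⟨ 1 ⟩ → ⟨ 3 ⟩ ∤ z
  ≡1⇒3∤ d d′ = ≡0⇒3∤-1 d′ d

  ≡-1⇒3∤ : ∀ {z} → ⟨ 3 ⟩ ∣ z + ⟨ 1 ⟩ → ⟨ 3 ⟩ ∤ z
  ≡-1⇒3∤ {z} d d′ = 3∤1 (∣-combine ⟨ 1 ⟩ (- ⟨ 1 ⟩)
    (solve 1 (λ x → ⟪ 1 ⟫ := ⟪ 1 ⟫ :* (x :+ ⟪ 1 ⟫) :+ :- ⟪ 1 ⟫ :* x) ≈-refl z) d d′)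

  ≡-1⇒3∤-1 : ∀ {z} → ⟨ 3 ⟩ ∣ z + ⟨ 1 ⟩ → ⟨ 3 ⟩ ∤ z - ⟨ 1 ⟩
  ≡-1⇒3∤-1 {z} d d′ = 3∤1 (∣-combine ⟨ 1 ⟩ (- ⟨ 1 ⟩)
    (solve 1 (λ x → ⟪ 1 ⟫ := ⟪ 1 ⟫ :* ⟪ 3 ⟫ :+ :- ⟪ 1 ⟫ :* (⟪ 1 ⟫ :* (x :+ ⟪ 1 ⟫) :+ :- ⟪ 1 ⟫ :* (x :- ⟪ 1 ⟫)))
      ≈-refl z)
    ∣ʳ-refl (∣-combine ⟨ 1 ⟩ (- ⟨ 1 ⟩) ≈-refl d d′))

  -- Zeros of z (z - 1) F(z) modulo powers of 3, for F of slope -1 modulo 3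

  module Core
    (F : Carrier → Carrier)
    (slope : ∀ x y → ∃[ s ] ⟨ 3 ⟩ ∣ s + ⟨ 1 ⟩ × F x - F y ≈ (x - y) * s)
    (3∣F0 : ⟨ 3 ⟩ ∣ F ⟨ 0 ⟩)
    (N : ℕ)
    where

    Root : Carrier → Set
    Root z = 3^ N ∣ z * (z - ⟨ 1 ⟩) * F z

    F-≈mod : ∀ k x y → 3^ k ∣ x - y → 3^ k ∣ F x → 3^ k ∣ F y
    F-≈mod k x y x≡y d with slope x y
    ... | s , _ , e = ∣-combine ⟨ 1 ⟩ (- s)
      (≈-trans (solve 2 (λ a b → b := ⟪ 1 ⟫ :* a :+ :- (a :- b)) ≈-refl (F x) (F y))
        (+-congˡ (≈-trans (-‿cong e) (solve 2 (λ d s → :- (d :* s) := :- s :* d) ≈-refl (x - y) s)))) d x≡y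

    F-≈mod⁻ : ∀ k x y → 3^ k ∣ F x → 3^ k ∣ F y → 3^ k ∣ x - y
    F-≈mod⁻ k x y d d′ with slope x y
    ... | s , 3∣s+1 , e = 3∤-cancelʳ k s (≡-1⇒3∤ 3∣s+1)
      (∣-combine ⟨ 1 ⟩ (- ⟨ 1 ⟩) (≈-trans (≈-sym e)
        (solve 2 (λ a b → a :- b := ⟪ 1 ⟫ :* a :+ :- ⟪ 1 ⟫ :* b) ≈-refl (F x) (F y))) d d′)

    3∣F⇒3∣ : ∀ {z} → ⟨ 3 ⟩ ∣ F z → ⟨ 3 ⟩ ∣ z
    3∣F⇒3∣ {z} d = ∣-scale ⟨ 1 ⟩ (solve 1 (λ z → z := ⟪ 1 ⟫ :* (z :- ⟪ 0 ⟫)) ≈-refl z)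
      (F-≈mod⁻ 1 z ⟨ 0 ⟩ d 3∣F0)

    Root-0⇐ : ∀ {z} → 3^ N ∣ z * F z → Root z
    Root-0⇐ {z} = ∣-scale (z - ⟨ 1 ⟩) (solve 3 (λ z w f → z :* w :* f := w :* (z :* f)) ≈-refl z (z - ⟨ 1 ⟩) (F z))

    Root-1⇐ : ∀ {z} → 3^ N ∣ z - ⟨ 1 ⟩ → Root z
    Root-1⇐ {z} = ∣-scale (z * F z) (solve 3 (λ z w f → z :* w :* f := z :* f :* w) ≈-refl z (z - ⟨ 1 ⟩) (F z))

    -- Modulo 3 the factors z and F(z) vanish only at 0, and z - 1 only at 1, so in each residue
    -- class the remaining factors can be cancelled. In the class of -1 nothing is divisible by 3,
    -- which 1 ≤ N forbids.
    Root⇒ : ∀ {z} → 1 ≤ N → Root z → (⟨ 3 ⟩ ∣ z × 3^ N ∣ z * F z) ⊎ 3^ N ∣ z - ⟨ 1 ⟩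
    Root⇒ {z} 1≤N d with residue z
    ... | inj₁ r = inj₁ (r , 3∤-cancelˡ N (z * F z) (≡0⇒3∤-1 r)
      (∣-scale ⟨ 1 ⟩ (solve 3 (λ z w f → w :* (z :* f) := ⟪ 1 ⟫ :* (z :* w :* f)) ≈-refl z (z - ⟨ 1 ⟩) (F z)) d))
    ... | inj₂ (inj₁ r) = inj₂ (3∤-cancelˡ N (z - ⟨ 1 ⟩) (3∤-* (≡1⇒3∤ r) (λ d → ≡1⇒3∤ r (3∣F⇒3∣ d)))
      (∣-scale ⟨ 1 ⟩ (solve 3 (λ z w f → z :* f :* w := ⟪ 1 ⟫ :* (z :* w :* f)) ≈-refl z (z - ⟨ 1 ⟩) (F z)) d))
    ... | inj₂ (inj₂ r) = contradiction (3^-mono 1≤N d)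
      (3∤-* (3∤-* (≡-1⇒3∤ r) (≡-1⇒3∤-1 r)) (λ d → ≡-1⇒3∤ r (3∣F⇒3∣ d)))

    -- Newton's iteration; its slope is that of F plus 1, hence divisible by 3.
    approximateZero : ∀ m → ∃[ z ] 3^ (suc m) ∣ F z
    approximateZero zero    = ⟨ 0 ⟩ , 3∣F0
    approximateZero (suc m) with approximateZero m
    ... | z , d with slope (z + F z) z
    ... | s , 3∣s+1 , e = z + F z , ∣ʳ-respʳ-≈ (begin
      (s + ⟨ 1 ⟩) * F z
        ≈⟨ solve 3 (λ z f s → (s :+ ⟪ 1 ⟫) :* f := (z :+ f :- z) :* s :+ f) ≈-refl z (F z) s ⟩
      (z + F z - z) * s + F z    ≈⟨ +-congʳ e ⟨
      F (z + F z) - F z + F z    ≈⟨ solve 2 (λ a b → a :- b :+ b := a) ≈-refl _ _ ⟩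
      F (z + F z)                ∎) (3^-∣* 1 (suc m) 3∣s+1 d)

    module Minimal
      (1≤N : 1 ≤ N) (z₀ : Carrier) (v₀ : ℕ)
      (fixed : Root z₀) (valuation : HasVal (z₀ * (z₀ - ⟨ 1 ⟩)) v₀) (nonzero : v₀ ≢ 0)
      (minimal : ∀ z m → Root z → HasVal (z * (z - ⟨ 1 ⟩)) m → m ≢ 0 → v₀ ≤ m)
      where

      module Small (2v₀<N : v₀ ℕ.+ v₀ < N) where

        k : ℕ
        k = N ∸ v₀

        v₀≤N : v₀ ≤ N
        v₀≤N = ℕₚ.≤-trans (ℕₚ.m≤m+n v₀ v₀) (ℕₚ.<⇒≤ 2v₀<N)

        v₀+k≡N : v₀ ℕ.+ k ≡ N
        v₀+k≡N = ℕₚ.m+[n∸m]≡n v₀≤N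

        v₀<k : v₀ < k
        v₀<k = ℕₚ.+-cancelˡ-< v₀ v₀ k (≡.subst (v₀ ℕ.+ v₀ <_) (≡.sym v₀+k≡N) 2v₀<N)

        z₀-facts : ⟨ 3 ⟩ ∣ z₀ × 3^ N ∣ z₀ * F z₀
        z₀-facts with Root⇒ 1≤N fixed
        ... | inj₁ p = p
        -- Otherwise z₀ ≡ 1 modulo 3^N, so v₀ ≥ N, against 2 v₀ < N.
        ... | inj₂ d = contradiction
          (ℕₚ.≤-trans (HasVal-≥ v₀ valuation (∣-scale z₀ ≈-refl d)) (ℕₚ.m≤m+n v₀ v₀))
          (ℕₚ.<⇒≱ 2v₀<N)

        z₀-val : HasVal z₀ v₀
        z₀-val = HasVal-cancel-unit v₀ valuation (≡0⇒3∤-1 (proj₁ z₀-facts))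

        3ᵏ∣Fz₀ : 3^ k ∣ F z₀
        3ᵏ∣Fz₀ = HasVal-cancelˡ v₀ k (F z₀) z₀-val (≡.subst (λ j → 3^ j ∣ z₀ * F z₀) (≡.sym v₀+k≡N) (proj₂ z₀-facts))

        -- If 3 divides z and v(z) = j < k, then v(F(z)) ≥ N - j > v₀, and v(F(z₀)) ≥ k > v₀ as
        -- well. Hence z ≡ z₀ modulo 3^(v₀ + 1), which forces j = v₀; now both values of F are
        -- divisible by 3^k, and so is z - z₀.
        only : ∀ {z} → Root z → 3^ k ∣ z - z₀ ⊎ 3^ k ∣ z ⊎ 3^ N ∣ z - ⟨ 1 ⟩
        only {z} root with Root⇒ 1≤N root
        ... | inj₂ d = inj₂ (inj₂ d)
        ... | inj₁ (3∣z , d) with 3^∣⊎HasVal k z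
        ...   | inj₁ d′ = inj₂ (inj₁ d′)
        ...   | inj₂ (j , j<k , zval) =
          inj₁ (F-≈mod⁻ k z z₀ (≡.subst (λ i → 3^ (N ∸ i) ∣ F z) j≡v₀ 3ᴺ⁻ʲ∣Fz) 3ᵏ∣Fz₀)
          where
          j+N∸j≡N : j ℕ.+ (N ∸ j) ≡ N
          j+N∸j≡N = ℕₚ.m+[n∸m]≡n (ℕₚ.≤-trans (ℕₚ.<⇒≤ j<k) (ℕₚ.m∸n≤m N v₀))

          v₀<N∸j : v₀ < N ∸ j
          v₀<N∸j = ℕₚ.+-cancelˡ-< j v₀ (N ∸ j) (≡.subst (j ℕ.+ v₀ <_)
            (≡.trans (ℕₚ.+-comm k v₀) (≡.trans v₀+k≡N (≡.sym j+N∸j≡N))) (ℕₚ.+-monoˡ-< v₀ j<k))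

          3ᴺ⁻ʲ∣Fz : 3^ (N ∸ j) ∣ F z
          3ᴺ⁻ʲ∣Fz = HasVal-cancelˡ j (N ∸ j) (F z) zval
            (≡.subst (λ i → 3^ i ∣ z * F z) (≡.sym j+N∸j≡N) d)

          z-val : HasVal z v₀
          z-val = HasVal-≈mod v₀ z₀-val (F-≈mod⁻ (suc v₀) z₀ z (3^-mono v₀<k 3ᵏ∣Fz₀) (3^-mono v₀<N∸j 3ᴺ⁻ʲ∣Fz))

          j≡v₀ : j ≡ v₀
          j≡v₀ = ℕₚ.≤-antisym (HasVal-≥ v₀ z-val (proj₁ zval)) (HasVal-≥ j zval (proj₁ z-val))

        -- Near z₀ the factors z and F(z) contribute v₀ and k; near 0 they exchange these
        -- contributions. Either way the total is v₀ + k = N.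
        all : ∀ {z} → 3^ k ∣ z - z₀ ⊎ 3^ k ∣ z ⊎ 3^ N ∣ z - ⟨ 1 ⟩ → Root z
        all {z} (inj₁ d) = Root-0⇐ (≡.subst (λ i → 3^ i ∣ z * F z) v₀+k≡N (3^-∣* v₀ k
          (∣-combine ⟨ 1 ⟩ ⟨ 1 ⟩ (solve 2 (λ z y → z := ⟪ 1 ⟫ :* y :+ ⟪ 1 ⟫ :* (z :- y)) ≈-refl z z₀)
            (proj₁ z₀-val) (3^-mono (ℕₚ.<⇒≤ v₀<k) d))
          (F-≈mod k z₀ z (∣-scale (- ⟨ 1 ⟩) (solve 2 (λ z y → y :- z := :- ⟪ 1 ⟫ :* (z :- y))
            ≈-refl z z₀) d) 3ᵏ∣Fz₀)))
        all {z} (inj₂ (inj₁ d)) = Root-0⇐ (≡.subst (λ i → 3^ i ∣ z * F z)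
          (≡.trans (ℕₚ.+-comm k v₀) v₀+k≡N) (3^-∣* k v₀ d
            (F-≈mod v₀ z₀ z (∣-combine ⟨ 1 ⟩ (- ⟨ 1 ⟩)
              (solve 2 (λ z y → y :- z := ⟪ 1 ⟫ :* y :+ :- ⟪ 1 ⟫ :* z) ≈-refl z z₀)
              (proj₁ z₀-val) (3^-mono (ℕₚ.<⇒≤ v₀<k) d)) (3^-mono (ℕₚ.<⇒≤ v₀<k) 3ᵏ∣Fz₀))))
        all (inj₂ (inj₂ d)) = Root-1⇐ d

      module Large (N≤2v₀ : N ≤ v₀ ℕ.+ v₀) where

        h l : ℕ
        -- This is ⌈N/2⌉, and also the exponent ⌊n/2⌋ of the theorem, as n = N + 1.
        h = ⌊ suc N /2⌋
        l = ⌊ N /2⌋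

        l+h≡N : l ℕ.+ h ≡ N
        l+h≡N = ℕₚ.⌊n/2⌋+⌈n/2⌉≡n N

        l≤h : l ≤ h
        l≤h = ℕₚ.⌊n/2⌋≤⌈n/2⌉ N

        -- As z - 1 is prime to 3, v(z (z - 1)) = j; it is nonzero, so minimality gives v₀ ≤ j.
        N≤2*val : ∀ j {z} → ⟨ 3 ⟩ ∣ z → HasVal z j → Root z → N ≤ j ℕ.+ j
        N≤2*val j {z} 3∣z zval root = ℕₚ.≤-trans N≤2v₀ (ℕₚ.+-mono-≤ v₀≤j v₀≤j)
          where
          v₀≤j : v₀ ≤ j
          v₀≤j = minimal z j root (HasVal-*-unit j zval (≡0⇒3∤-1 3∣z)) (λ j≡0 → ℕₚ.<⇒≢ (HasVal-≥ j zval 3∣z) (≡.sym j≡0))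

        only : ∀ {z} → Root z → 3^ h ∣ z ⊎ 3^ N ∣ z - ⟨ 1 ⟩
        only {z} root with Root⇒ 1≤N root
        ... | inj₂ d = inj₂ d
        ... | inj₁ (3∣z , _) with 3^∣⊎HasVal h z
        ...   | inj₁ d = inj₁ d
        -- From j < h follows j ≤ h - 1 ≤ l, so 2 j < l + h = N.
        ...   | inj₂ (j , j<h , zval) = contradiction (N≤2*val j 3∣z zval root) (ℕₚ.<⇒≱
          (≡.subst (j ℕ.+ j <_) l+h≡N (ℕₚ.+-mono-≤-< (ℕₚ.≤-pred (ℕₚ.≤-trans j<h h≤1+l)) j<h)))
          where
          h≤1+l : h ≤ suc l
          h≤1+l = ℕₚ.⌊n/2⌋≤⌈n/2⌉ (suc N)

        -- An approximate zero z of F has the same valuation as F(0), because F preserves valuations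
        -- of differences and z is accurate beyond j. Since z is also a root, a valuation j < l
        -- would contradict N ≤ 2 j.
        3ˡ∣F0 : 3^ l ∣ F ⟨ 0 ⟩
        3ˡ∣F0 with 3^∣⊎HasVal l (F ⟨ 0 ⟩)
        ... | inj₁ d = d
        ... | inj₂ (j , j<l , (3ʲ∣F0 , 3ʲ⁺¹∤F0)) with approximateZero N
        ...   | z , d = contradiction (N≤2*val j 3∣z zval (Root-0⇐ (∣-scale z ≈-refl (3^-mono {N} (ℕₚ.n≤1+n N) d))))
          (ℕₚ.<⇒≱ (≡.subst (j ℕ.+ j <_) l+h≡N (ℕₚ.+-mono-<-≤ j<l (ℕₚ.≤-trans (ℕₚ.<⇒≤ j<l) l≤h))))
          where
          1+j≤1+N : suc j ≤ suc N
          1+j≤1+N = ℕₚ.≤-trans j<l (ℕₚ.≤-trans (ℕₚ.m≤m+n l h) (ℕₚ.≤-trans (ℕₚ.≤-reflexive l+h≡N) (ℕₚ.n≤1+n N)))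

          3∣z : ⟨ 3 ⟩ ∣ z
          3∣z = 3∣F⇒3∣ (3^-mono {1} {suc N} (s≤s z≤n) d)

          zval : HasVal z j
          zval = ∣-scale ⟨ 1 ⟩ (solve 1 (λ z → z := ⟪ 1 ⟫ :* (z :- ⟪ 0 ⟫)) ≈-refl z)
                   (F-≈mod⁻ j z ⟨ 0 ⟩ (3^-mono (ℕₚ.≤-trans (ℕₚ.n≤1+n j) 1+j≤1+N) d) 3ʲ∣F0) ,
            λ d′ → 3ʲ⁺¹∤F0 (F-≈mod (suc j) z ⟨ 0 ⟩
              (∣-scale ⟨ 1 ⟩ (solve 1 (λ z → z :- ⟪ 0 ⟫ := ⟪ 1 ⟫ :* z) ≈-refl z) d′) (3^-mono 1+j≤1+N d))

        all : ∀ {z} → 3^ h ∣ z ⊎ 3^ N ∣ z - ⟨ 1 ⟩ → Root z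
        -- The factor z contributes h; as l ≤ h, F(z) ≡ F(0) ≡ 0 modulo 3^l contributes the missing
        -- l.
        all {z} (inj₁ d) = Root-0⇐ (≡.subst (λ i → 3^ i ∣ z * F z) (≡.trans (ℕₚ.+-comm h l) l+h≡N)
          (3^-∣* h l d (F-≈mod l ⟨ 0 ⟩ z
            (∣-scale (- ⟨ 1 ⟩) (solve 1 (λ z → ⟪ 0 ⟫ :- z := :- ⟪ 1 ⟫ :* z) ≈-refl z) (3^-mono l≤h d)) 3ˡ∣F0)))
        all (inj₂ d) = Root-1⇐ d

  -- Valuations of factorials

  ⟨⟩-suc : ∀ n → ⟨ suc n ⟩ ≈ ⟨ n ⟩ + ⟨ 1 ⟩
  ⟨⟩-suc n = ≈-trans (+-homo (+ 1) (+ n)) (+-comm _ _)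

  ⟨⟩-* : ∀ m n → ⟨ m ℕ.* n ⟩ ≈ ⟨ m ⟩ * ⟨ n ⟩
  ⟨⟩-* m n = ≈-trans (≈-reflexive (≡.cong (integer R ⟨_⟩) (ℤₚ.pos-* m n))) (*-homo (+ m) (+ n))

  factorial : ℕ → Carrier
  factorial zero    = ⟨ 1 ⟩
  factorial (suc n) = ⟨ suc n ⟩ * factorial n

  module _ (m : ℕ) where
    private x = ⟨ m ⟩

    factorial-1+3m : factorial (1 ℕ.+ m ℕ.* 3) ≈ (x * ⟨ 3 ⟩ + ⟨ 1 ⟩) * factorial (m ℕ.* 3)
    factorial-1+3m = *-congʳ (≈-trans (⟨⟩-suc (m ℕ.* 3)) (+-congʳ (⟨⟩-* m 3)))

    factorial-2+3m : factorial (2 ℕ.+ m ℕ.* 3) ≈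
      (x * ⟨ 3 ⟩ + ⟨ 2 ⟩) * (x * ⟨ 3 ⟩ + ⟨ 1 ⟩) * factorial (m ℕ.* 3)
    factorial-2+3m = ≈-trans (*-cong
      (≈-trans (+-homo (+ 2) (+ (m ℕ.* 3))) (≈-trans (+-congˡ (⟨⟩-* m 3)) (+-comm _ _))) factorial-1+3m)
      (≈-sym (*-assoc _ _ _))

    factorial-3+3m : factorial (3 ℕ.+ m ℕ.* 3) ≈
      (x * ⟨ 3 ⟩ + ⟨ 3 ⟩) * ((x * ⟨ 3 ⟩ + ⟨ 2 ⟩) * (x * ⟨ 3 ⟩ + ⟨ 1 ⟩)) * factorial (m ℕ.* 3)
    factorial-3+3m = ≈-trans (*-cong
      (≈-trans (+-homo (+ 3) (+ (m ℕ.* 3))) (≈-trans (+-congˡ (⟨⟩-* m 3)) (+-comm _ _))) factorial-2+3m)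
      (≈-sym (*-assoc _ _ _))

  -- Being prime to 3 would not be enough: the slope of F contains M u, which must be congruent to u
  -- modulo 3.
  PrincipalUnit : Carrier → Set
  PrincipalUnit a = ⟨ 3 ⟩ ∣ a - ⟨ 1 ⟩

  PrincipalUnit-* : ∀ {a b} → PrincipalUnit a → PrincipalUnit b → PrincipalUnit (a * b)
  PrincipalUnit-* {a} {b} p q = ∣-combine b ⟨ 1 ⟩
    (solve 2 (λ a b → a :* b :- ⟪ 1 ⟫ := b :* (a :- ⟪ 1 ⟫) :+ ⟪ 1 ⟫ :* (b :- ⟪ 1 ⟫)) ≈-refl a b) p q

  1+3m-principal : ∀ x → PrincipalUnit (x * ⟨ 3 ⟩ + ⟨ 1 ⟩)
  1+3m-principal x = x , solve 1 (λ x → x :* ⟪ 3 ⟫ := x :* ⟪ 3 ⟫ :+ ⟪ 1 ⟫ :- ⟪ 1 ⟫) ≈-refl x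

  -2-3m-principal : ∀ x → PrincipalUnit (- (x * ⟨ 3 ⟩ + ⟨ 2 ⟩))
  -2-3m-principal x = - (x + ⟨ 1 ⟩) ,
    solve 1 (λ x → :- (x :+ ⟪ 1 ⟫) :* ⟪ 3 ⟫ := :- (x :* ⟪ 3 ⟫ :+ ⟪ 2 ⟫) :- ⟪ 1 ⟫) ≈-refl x

  -- The multiples of 3 among the factors of (3m)! make up 3^m m!. The others come in pairs (3x + 1)
  -- (3x + 2), and negating 3x + 2 makes both members ≡ 1 (mod 3). Divisibility, unlike equality,
  -- ignores these signs.
  factorial-3m : ∀ m → ∃[ a ] PrincipalUnit a × factorial (m ℕ.* 3) ∣ 3^ m * (factorial m * a)
  factorial-3m zero = ⟨ 1 ⟩ , (⟨ 0 ⟩ , solve 0 (⟪ 0 ⟫ :* ⟪ 3 ⟫ := ⟪ 1 ⟫ :- ⟪ 1 ⟫) ≈-refl) ,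
    (⟨ 1 ⟩ , solve 0 (⟪ 1 ⟫ :* ⟪ 1 ⟫ := ⟪ 1 ⟫ :* (⟪ 1 ⟫ :* ⟪ 1 ⟫)) ≈-refl)
  factorial-3m (suc m) with factorial-3m m
  ... | a , a-unit , d = - y * z * a ,
      PrincipalUnit-* (PrincipalUnit-* (-2-3m-principal x) (1+3m-principal x)) a-unit ,
      ∣-scale (- ⟨ 1 ⟩) (begin
        3^ (suc m) * (⟨ suc m ⟩ * factorial m * (- y * z * a))
          ≈⟨ *-cong (3^-suc m) (*-congʳ (*-congʳ (⟨⟩-suc m))) ⟩
        ⟨ 3 ⟩ * 3^ m * ((x + ⟨ 1 ⟩) * factorial m * (- y * z * a))
          ≈⟨ solve 4 (λ x p f a →
               let y = x :* ⟪ 3 ⟫ :+ ⟪ 2 ⟫ ; z = x :* ⟪ 3 ⟫ :+ ⟪ 1 ⟫ in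
               ⟪ 3 ⟫ :* p :* ((x :+ ⟪ 1 ⟫) :* f :* (:- y :* z :* a)) :=
               :- ⟪ 1 ⟫ :* ((x :* ⟪ 3 ⟫ :+ ⟪ 3 ⟫) :* (y :* z) :* (p :* (f :* a)))) ≈-refl x (3^ m) (factorial m) a ⟩
        - ⟨ 1 ⟩ * ((x * ⟨ 3 ⟩ + ⟨ 3 ⟩) * (y * z) * (3^ m * (factorial m * a))) ∎)
      (∣ʳ-respˡ-≈ (≈-sym (factorial-3+3m m)) (∣-* ∣ʳ-refl d))
    where
    x y z : Carrier
    x = ⟨ m ⟩
    y = x * ⟨ 3 ⟩ + ⟨ 2 ⟩
    z = x * ⟨ 3 ⟩ + ⟨ 1 ⟩

  -- This expresses v(i!) ≤ e without division: a clears the part of i! prime to 3.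
  FactorialDivides : ℕ → ℕ → Set
  FactorialDivides i e = ∃[ a ] PrincipalUnit a × factorial i ∣ 3^ e * a

  FactorialDivides-mono : ∀ i e e′ → e ≤ e′ → FactorialDivides i e → FactorialDivides i e′
  FactorialDivides-mono i e e′ e≤e′ (a , p , d) = a , p , ∣-scale (3^ (e′ ∸ e)) (begin
    3^ e′ * a                   ≈⟨ *-congʳ (≈-reflexive (≡.cong 3^ (ℕₚ.m∸n+n≡m e≤e′))) ⟨
    3^ (e′ ∸ e ℕ.+ e) * a       ≈⟨ *-congʳ (3^-+ (e′ ∸ e) e) ⟩
    3^ (e′ ∸ e) * 3^ e * a      ≈⟨ *-assoc _ _ _ ⟩
    3^ (e′ ∸ e) * (3^ e * a)    ∎) d

  -- One step of Legendre's formula: v((r + 3m)!) = m + v(m!), as the r additional factors are prime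
  -- to 3.
  factorial-r+3m : ∀ r m e → FactorialDivides m e → FactorialDivides (toℕ {3} r ℕ.+ m ℕ.* 3) (m ℕ.+ e)
  factorial-r+3m r m e (b , b-unit , fm∣3ᵉb) with factorial-3m m
  ... | a , a-unit , d = extend r
    where
    c : Carrier
    c = a * b

    c-unit : PrincipalUnit c
    c-unit = PrincipalUnit-* a-unit b-unit

    f3m∣ : factorial (m ℕ.* 3) ∣ 3^ (m ℕ.+ e) * c
    f3m∣ = ∣ʳ-trans d (∣-scale ⟨ 1 ⟩ (begin
      3^ (m ℕ.+ e) * (a * b)      ≈⟨ *-congʳ (3^-+ m e) ⟩
      3^ m * 3^ e * (a * b)
        ≈⟨ solve 4 (λ p q a b → p :* q :* (a :* b) := ⟪ 1 ⟫ :* (p :* a :* (q :* b))) ≈-refl _ _ _ _ ⟩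
      ⟨ 1 ⟩ * (3^ m * a * (3^ e * b)) ∎) (∣ʳ-respˡ-≈
        (solve 3 (λ p f a → p :* a :* f := p :* (f :* a)) ≈-refl (3^ m) (factorial m) a)
        (∣-* ∣ʳ-refl fm∣3ᵉb)))

    x y z : Carrier
    x = ⟨ m ⟩
    y = x * ⟨ 3 ⟩ + ⟨ 2 ⟩
    z = x * ⟨ 3 ⟩ + ⟨ 1 ⟩

    extend : ∀ r → FactorialDivides (toℕ {3} r ℕ.+ m ℕ.* 3) (m ℕ.+ e)
    extend fzero = c , c-unit , f3m∣
    extend (fsuc fzero) = z * c , PrincipalUnit-* (1+3m-principal x) c-unit ,
      ∣ʳ-respˡ-≈ (≈-sym (factorial-1+3m m)) (∣-scale ⟨ 1 ⟩
        (solve 3 (λ p z c → p :* (z :* c) := ⟪ 1 ⟫ :* (z :* (p :* c))) ≈-refl _ _ _) (∣-* {z} ∣ʳ-refl f3m∣))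
    extend (fsuc (fsuc fzero)) = - y * z * c ,
      PrincipalUnit-* (PrincipalUnit-* (-2-3m-principal x) (1+3m-principal x)) c-unit ,
      ∣ʳ-respˡ-≈ (≈-sym (factorial-2+3m m)) (∣-scale (- ⟨ 1 ⟩)
        (solve 4 (λ p y z c → p :* (:- y :* z :* c) := :- ⟪ 1 ⟫ :* (y :* z :* (p :* c))) ≈-refl _ _ _ _)
        (∣-* {y * z} ∣ʳ-refl f3m∣))

  m+m≤m*3 : ∀ m → m ℕ.+ m ≤ m ℕ.* 3
  m+m≤m*3 m = ≡.subst (m ℕ.+ m ≤_) (m+m+m≡m*3 m) (ℕₚ.m≤m+n (m ℕ.+ m) m)
    where
    m+m+m≡m*3 : ∀ m → m ℕ.+ m ℕ.+ m ≡ m ℕ.* 3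
    m+m+m≡m*3 = ℕSolver.solve-∀

  -- The crude bound v(n!) ≤ n - 1 follows from its own instance at the quotient of n by 3; applied
  -- to that quotient it also yields the sharper `factorial-val≤`.
  factorial-val< : ∀ i → FactorialDivides (suc i) i
  factorial-val< = <-rec _ step
    where
    step : ∀ i → (∀ {j} → j < i → FactorialDivides (suc j) j) → FactorialDivides (suc i) i
    step 0 rec = ⟨ 1 ⟩ , (⟨ 0 ⟩ , solve 0 (⟪ 0 ⟫ :* ⟪ 3 ⟫ := ⟪ 1 ⟫ :- ⟪ 1 ⟫) ≈-refl) , ∣ʳ-refl
    step 1 rec = - ⟨ 2 ⟩ , (- ⟨ 1 ⟩ , solve 0 (:- ⟪ 1 ⟫ :* ⟪ 3 ⟫ := :- ⟪ 2 ⟫ :- ⟪ 1 ⟫) ≈-refl) ,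
      (- ⟨ 3 ⟩ , solve 0 (:- ⟪ 3 ⟫ :* (⟪ 2 ⟫ :* (⟪ 1 ⟫ :* ⟪ 1 ⟫)) := ⟪ 3 ⟫ :* :- ⟪ 2 ⟫) ≈-refl)
    step i@(suc (suc _)) rec with suc i divMod 3
    ... | result zero (fsuc (fsuc fzero)) ()
    ... | result (suc m) r eq = ≡.subst (λ k → FactorialDivides k i) (≡.sym eq)
      (FactorialDivides-mono (toℕ r ℕ.+ suc m ℕ.* 3) (suc m ℕ.+ m) i bound
        (factorial-r+3m r (suc m) m (rec (ℕₚ.≤-trans (ℕₚ.m≤m+n (suc m) m) bound))))
      where
      bound : suc m ℕ.+ m ≤ i
      bound = ℕₚ.≤-pred (≡.subst (suc (suc m ℕ.+ m) ≤_) (≡.sym eq)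
        (ℕₚ.≤-trans (s≤s (s≤s (ℕₚ.≤-trans (m+m≤m*3 m) (ℕₚ.n≤1+n _)))) (ℕₚ.m≤n+m (suc m ℕ.* 3) (toℕ r))))

  -- The bound is v(n!) ≤ n - 3, one less than the exponent of 3 in t^(n - 2). It fails for n = 3,
  -- which is why t C(k, 3) is treated together with the leading term.
  factorial-val≤ : ∀ j → FactorialDivides (4 ℕ.+ j) (1 ℕ.+ j)
  factorial-val≤ j with (4 ℕ.+ j) divMod 3
  ... | result zero (fsuc (fsuc fzero)) ()
  ... | result (suc m) r eq = ≡.subst (λ k → FactorialDivides k (1 ℕ.+ j)) (≡.sym eq)
    (FactorialDivides-mono (toℕ r ℕ.+ suc m ℕ.* 3) (suc m ℕ.+ m) (1 ℕ.+ j) (bound m r eq)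
      (factorial-r+3m r (suc m) m (factorial-val< m)))
    where
    bound : ∀ m r → 4 ℕ.+ j ≡ toℕ {3} r ℕ.+ suc m ℕ.* 3 → suc m ℕ.+ m ≤ 1 ℕ.+ j
    -- With remainder 0 the quotient 1 would mean 4 + j = 3, so the quotient is at least 2.
    bound (suc m) fzero eq = ≡.subst (suc (suc m) ℕ.+ suc m ≤_) (≡.sym (ℕₚ.+-cancelˡ-≡ 3 _ _ eq))
      (≡.subst (_≤ 3 ℕ.+ m ℕ.* 3) (≡.cong (2 ℕ.+_) (≡.sym (ℕₚ.+-suc m m))) (ℕₚ.+-monoʳ-≤ 3 (m+m≤m*3 m)))
    bound m (fsuc r) eq = ≡.subst (suc m ℕ.+ m ≤_)
      (≡.sym (ℕₚ.+-cancelˡ-≡ 3 _ _ (≡.trans eq (x+[3+y]≡3+[x+y] (toℕ (fsuc r)) (m ℕ.* 3)))))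
      (s≤s (ℕₚ.≤-trans (m+m≤m*3 m) (ℕₚ.m≤n+m (m ℕ.* 3) (toℕ r))))
      where
      x+[3+y]≡3+[x+y] : ∀ x y → x ℕ.+ (3 ℕ.+ y) ≡ 3 ℕ.+ (x ℕ.+ y)
      x+[3+y]≡3+[x+y] = ℕSolver.solve-∀

  -- Falling factorials and binomial coefficients

  fallingFactorial : Carrier → ℕ → Carrier
  fallingFactorial z zero    = ⟨ 1 ⟩
  fallingFactorial z (suc i) = fallingFactorial z i * (z - ⟨ i ⟩)

  binomial : ℕ → ℕ → Carrier
  binomial k       zero    = ⟨ 1 ⟩
  binomial zero    (suc i) = ⟨ 0 ⟩
  binomial (suc k) (suc i) = binomial k i + binomial k (suc i)

  binomial-1 : ∀ k → binomial k 1 ≈ ⟨ k ⟩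
  binomial-1 zero    = ≈-refl
  binomial-1 (suc k) = ≈-trans (+-congˡ (binomial-1 k)) (≈-trans (+-comm _ _) (≈-sym (⟨⟩-suc k)))

  fallingFactorial-0 : ∀ i → fallingFactorial ⟨ 0 ⟩ (suc i) ≈ ⟨ 0 ⟩
  fallingFactorial-0 zero    = solve 0 (⟪ 1 ⟫ :* (⟪ 0 ⟫ :- ⟪ 0 ⟫) := ⟪ 0 ⟫) ≈-refl
  fallingFactorial-0 (suc i) = ≈-trans (*-congʳ (fallingFactorial-0 i))
    (solve 1 (λ x → ⟪ 0 ⟫ :* x := ⟪ 0 ⟫) ≈-refl _)

  fallingFactorial-suc : ∀ k i → fallingFactorial ⟨ suc k ⟩ (suc i) ≈ ⟨ suc k ⟩ * fallingFactorial ⟨ k ⟩ i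
  fallingFactorial-suc k zero    = solve 1 (λ x → ⟪ 1 ⟫ :* (x :- ⟪ 0 ⟫) := x :* ⟪ 1 ⟫) ≈-refl ⟨ suc k ⟩
  fallingFactorial-suc k (suc i) = begin
    fallingFactorial ⟨ suc k ⟩ (suc i) * (⟨ suc k ⟩ - ⟨ suc i ⟩)
      ≈⟨ *-cong (fallingFactorial-suc k i) (+-cong (⟨⟩-suc k) (-‿cong (⟨⟩-suc i))) ⟩
    ⟨ suc k ⟩ * fallingFactorial ⟨ k ⟩ i * (⟨ k ⟩ + ⟨ 1 ⟩ - (⟨ i ⟩ + ⟨ 1 ⟩))
      ≈⟨ solve 4 (λ s f k i → s :* f :* (k :+ ⟪ 1 ⟫ :- (i :+ ⟪ 1 ⟫)) := s :* (f :* (k :- i))) ≈-refl _ _ _ _ ⟩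
    ⟨ suc k ⟩ * (fallingFactorial ⟨ k ⟩ i * (⟨ k ⟩ - ⟨ i ⟩)) ∎

  factorial*binomial : ∀ k i → factorial i * binomial k i ≈ fallingFactorial ⟨ k ⟩ i
  factorial*binomial k       zero    = solve 0 (⟪ 1 ⟫ :* ⟪ 1 ⟫ := ⟪ 1 ⟫) ≈-refl
  factorial*binomial zero    (suc i) = ≈-trans
    (solve 1 (λ x → x :* ⟪ 0 ⟫ := ⟪ 0 ⟫) ≈-refl _) (≈-sym (fallingFactorial-0 i))
  factorial*binomial (suc k) (suc i) = begin
    ⟨ suc i ⟩ * factorial i * (binomial k i + binomial k (suc i))
      ≈⟨ solve 4 (λ s f a b → s :* f :* (a :+ b) := s :* (f :* a) :+ s :* f :* b) ≈-refl _ _ _ _ ⟩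
    ⟨ suc i ⟩ * (factorial i * binomial k i) + factorial (suc i) * binomial k (suc i)
      ≈⟨ +-cong (*-cong (⟨⟩-suc i) (factorial*binomial k i)) (factorial*binomial k (suc i)) ⟩
    (⟨ i ⟩ + ⟨ 1 ⟩) * f + f * (⟨ k ⟩ - ⟨ i ⟩)
      ≈⟨ solve 3 (λ i f k → (i :+ ⟪ 1 ⟫) :* f :+ f :* (k :- i) := (k :+ ⟪ 1 ⟫) :* f) ≈-refl ⟨ i ⟩ f ⟨ k ⟩ ⟩
    (⟨ k ⟩ + ⟨ 1 ⟩) * f
      ≈⟨ *-congʳ (⟨⟩-suc k) ⟨
    ⟨ suc k ⟩ * f
      ≈⟨ fallingFactorial-suc k i ⟨
    fallingFactorial ⟨ suc k ⟩ (suc i) ∎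
    where f = fallingFactorial ⟨ k ⟩ i

  fallingFactorialFrom2 : Carrier → ℕ → Carrier
  fallingFactorialFrom2 z zero    = ⟨ 1 ⟩
  fallingFactorialFrom2 z (suc j) = fallingFactorialFrom2 z j * (z - ⟨ 2 ℕ.+ j ⟩)

  fallingFactorial-2+ : ∀ z j → fallingFactorial z (2 ℕ.+ j) ≈ z * (z - ⟨ 1 ⟩) * fallingFactorialFrom2 z j
  fallingFactorial-2+ z zero    = solve 1 (λ z → ⟪ 1 ⟫ :* (z :- ⟪ 0 ⟫) :* (z :- ⟪ 1 ⟫) := z :* (z :- ⟪ 1 ⟫) :* ⟪ 1 ⟫)
    ≈-refl z
  fallingFactorial-2+ z (suc j) = ≈-trans (*-congʳ (fallingFactorial-2+ z j)) (*-assoc _ _ _)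

  -- Divided differences and density of the natural numbers

  Lip : (Carrier → Carrier) → Set
  Lip f = ∀ x y → x - y ∣ f x - f y

  Lip-const : ∀ c → Lip (λ _ → c)
  Lip-const c x y = ⟨ 0 ⟩ , solve 3 (λ x y c → ⟪ 0 ⟫ :* (x :- y) := c :- c) ≈-refl x y c

  Lip-id : Lip (λ x → x)
  Lip-id x y = ∣ʳ-refl

  Lip-+ : ∀ {f g} → Lip f → Lip g → Lip (λ x → f x + g x)
  Lip-+ {f} {g} p q x y = ∣-combine ⟨ 1 ⟩ ⟨ 1 ⟩
    (solve 4 (λ a b c d → a :+ c :- (b :+ d) := ⟪ 1 ⟫ :* (a :- b) :+ ⟪ 1 ⟫ :* (c :- d))
      ≈-refl (f x) (f y) (g x) (g y))
    (p x y) (q x y)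

  Lip-* : ∀ {f g} → Lip f → Lip g → Lip (λ x → f x * g x)
  Lip-* {f} {g} p q x y = ∣-combine (g x) (f y)
    (solve 4 (λ a b c d → a :* c :- b :* d := c :* (a :- b) :+ b :* (c :- d)) ≈-refl (f x) (f y) (g x) (g y))
    (p x y) (q x y)

  -- The closure properties of `Lip` replace a formal treatment of polynomials: divisibility of
  -- differences is all that is needed of E and G.
  Lip-fallingFactorialFrom2 : ∀ j → Lip (λ z → fallingFactorialFrom2 z j)
  Lip-fallingFactorialFrom2 zero    = Lip-const ⟨ 1 ⟩
  Lip-fallingFactorialFrom2 (suc j) = Lip-* (Lip-fallingFactorialFrom2 j) (Lip-+ Lip-id (Lip-const (- ⟨ 2 ℕ.+ j ⟩)))

  3∤2 : ⟨ 3 ⟩ ∤ ⟨ 2 ⟩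
  3∤2 d = 3∤1 (∣-combine ⟨ 1 ⟩ (- ⟨ 1 ⟩) (solve 0 (⟪ 1 ⟫ := ⟪ 1 ⟫ :* ⟪ 3 ⟫ :+ :- ⟪ 1 ⟫ :* ⟪ 2 ⟫) ≈-refl) ∣ʳ-refl d)

  ≡2⇒3∤ : ∀ {z} → ⟨ 3 ⟩ ∣ z - ⟨ 2 ⟩ → ⟨ 3 ⟩ ∤ z
  ≡2⇒3∤ {z} d d′ = 3∤2 (∣-combine ⟨ 1 ⟩ (- ⟨ 1 ⟩)
    (solve 1 (λ z → ⟪ 2 ⟫ := ⟪ 1 ⟫ :* z :+ :- ⟪ 1 ⟫ :* (z :- ⟪ 2 ⟫)) ≈-refl z) d′ d)

  dense : ∀ m z → ∃[ k ] 3^ m ∣ ⟨ k ⟩ - z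
  dense zero    z = 0 , 3^0∣ _
  dense (suc m) z = [ lift 0 ∘ ∣-scale ⟨ 1 ⟩ (solve 1 (λ z → z :- ⟪ 0 ⟫ := ⟪ 1 ⟫ :* z) ≈-refl z)
    , [ lift 1
      , (λ d → lift 2 (∣-combine ⟨ 1 ⟩ (- ⟨ 1 ⟩)
          (solve 1 (λ z → z :- ⟪ 2 ⟫ := ⟪ 1 ⟫ :* (z :+ ⟪ 1 ⟫) :+ :- ⟪ 1 ⟫ :* ⟪ 3 ⟫) ≈-refl z) d ∣ʳ-refl)) ]′ ]′
    (residue z)
    where
    lift : ∀ r → ⟨ 3 ⟩ ∣ z - ⟨ r ⟩ → ∃[ k ] 3^ (suc m) ∣ ⟨ k ⟩ - z
    lift r d with ∣⇒coset d
    ... | y , z≈r+3y with dense m y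
    ... | k , k≡y = r ℕ.+ 3 ℕ.* k , ∣-scale ⟨ 1 ⟩ (begin
      ⟨ r ℕ.+ 3 ℕ.* k ⟩ - z
        ≈⟨ +-cong (≈-trans (+-homo (+ r) (+ (3 ℕ.* k))) (+-congˡ (⟨⟩-* 3 k))) (-‿cong z≈r+3y) ⟩
      ⟨ r ⟩ + ⟨ 3 ⟩ * ⟨ k ⟩ - (⟨ r ⟩ + ⟨ 3 ⟩ * y)
        ≈⟨ solve 3 (λ r k y →
             r :+ ⟪ 3 ⟫ :* k :- (r :+ ⟪ 3 ⟫ :* y) := ⟪ 1 ⟫ :* (⟪ 3 ⟫ :* (k :- y))) ≈-refl ⟨ r ⟩ ⟨ k ⟩ y ⟩
      ⟨ 1 ⟩ * (⟨ 3 ⟩ * (⟨ k ⟩ - y)) ∎) (3^-∣* 1 m ∣ʳ-refl k≡y)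

  -- The binomial expansion of ι(z) - z

  Fixed : (Carrier → Carrier) → ℕ → Pred Carrier 0ℓ
  Fixed f n z = 3^ n ∣ f z - z

  -- Here n = N + 1, one factor 3 being taken by t = 3u. The slope and one value determine F modulo
  -- 3; the value is taken at 2 because u (z - 2) vanishes there, whatever u is.
  record FixedPointEquation (u : Carrier) (f : Carrier → Carrier) (N : ℕ) : Set where
    field
      F        : Carrier → Carrier
      slope    : ∀ x y → ∃[ s ] ⟨ 3 ⟩ ∣ s - u × F x - F y ≈ (x - y) * s
      F[2]≡1   : ⟨ 3 ⟩ ∣ F ⟨ 2 ⟩ - ⟨ 1 ⟩
      sound    : ∀ {z} → Fixed f (suc N) z → 3^ N ∣ z * (z - ⟨ 1 ⟩) * F z
      complete : ∀ {z} → 3^ N ∣ z * (z - ⟨ 1 ⟩) * F z → Fixed f (suc N) z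

  module Expansion (q u : Carrier) (q≈1+3u : q ≈ ⟨ 1 ⟩ + ⟨ 3 ⟩ * u) where

    t : Carrier
    t = ⟨ 3 ⟩ * u

    9∣q-c⇒ : ∀ {c} d → ⟨ c ⟩ ≈ ⟨ 1 ⟩ + ⟨ 3 ⟩ * d → ⟨ 9 ⟩ ∣ q - ⟨ c ⟩ → ⟨ 3 ⟩ ∣ u - d
    9∣q-c⇒ {c} d e h = 3^-cancelˡ 1 1 (u - d) (∣-scale ⟨ 1 ⟩ (≈-sym (begin
      ⟨ 1 ⟩ * (q - ⟨ c ⟩)                                ≈⟨ *-congˡ (+-cong q≈1+3u (-‿cong e)) ⟩
      ⟨ 1 ⟩ * (⟨ 1 ⟩ + ⟨ 3 ⟩ * u - (⟨ 1 ⟩ + ⟨ 3 ⟩ * d))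
        ≈⟨ solve 2 (λ u d → ⟪ 1 ⟫ :* (⟪ 1 ⟫ :+ ⟪ 3 ⟫ :* u :- (⟪ 1 ⟫ :+ ⟪ 3 ⟫ :* d)) := ⟪ 3 ⟫ :* (u :- d)) ≈-refl u d ⟩
      ⟨ 3 ⟩ * (u - d)                                    ∎)) h)

    -- iteratedSum m is the m-fold indefinite sum of k ↦ qᵏ, which equals Σᵢ C(k, m + i) tⁱ.
    iteratedSum : ℕ → ℕ → Carrier
    iteratedSum zero    k       = q ^ k
    iteratedSum (suc m) zero    = ⟨ 0 ⟩
    iteratedSum (suc m) (suc k) = iteratedSum (suc m) k + iteratedSum m k

    -- Since t = q - 1, multiplication by t undoes a summation up to an initial term; in k both
    -- sides obey the same recursion, by Pascal's rule. Iterating this gives the binomial expansion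
    -- with an exact remainder, so no infinite series is needed.
    iteratedSum-step : ∀ m k → iteratedSum m k ≈ binomial k m + t * iteratedSum (suc m) k
    iteratedSum-step zero    zero    = ≈-trans (≈-sym 1-homo)
      (solve 1 (λ t → ⟪ 1 ⟫ := ⟪ 1 ⟫ :+ t :* ⟪ 0 ⟫) ≈-refl t)
    iteratedSum-step (suc m) zero    = solve 1 (λ t → ⟪ 0 ⟫ := ⟪ 0 ⟫ :+ t :* ⟪ 0 ⟫) ≈-refl t
    iteratedSum-step zero    (suc k) = begin
      q * q ^ k                                        ≈⟨ *-congʳ q≈1+3u ⟩
      (⟨ 1 ⟩ + t) * q ^ k
        ≈⟨ solve 2 (λ t Q → (⟪ 1 ⟫ :+ t) :* Q := Q :+ t :* Q) ≈-refl t (q ^ k) ⟩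
      q ^ k + t * q ^ k                                ≈⟨ +-congʳ (iteratedSum-step 0 k) ⟩
      ⟨ 1 ⟩ + t * iteratedSum 1 k + t * q ^ k
        ≈⟨ solve 3 (λ t B Q → ⟪ 1 ⟫ :+ t :* B :+ t :* Q := ⟪ 1 ⟫ :+ t :* (B :+ Q)) ≈-refl t _ _ ⟩
      ⟨ 1 ⟩ + t * (iteratedSum 1 k + q ^ k)            ∎
    iteratedSum-step (suc m) (suc k) = begin
      iteratedSum (suc m) k + iteratedSum m k
        ≈⟨ +-cong (iteratedSum-step (suc m) k) (iteratedSum-step m k) ⟩
      binomial k (suc m) + t * iteratedSum (2 ℕ.+ m) k + (binomial k m + t * iteratedSum (suc m) k)
        ≈⟨ solve 5 (λ a b c d t → a :+ t :* b :+ (c :+ t :* d) := c :+ a :+ t :* (b :+ d)) ≈-refl _ _ _ _ t ⟩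
      binomial k m + binomial k (suc m) + t * (iteratedSum (2 ℕ.+ m) k + iteratedSum (suc m) k) ∎

    iteratedSum-1 : ∀ k → iteratedSum 1 k ≈ sum {k} (λ i → q ^ toℕ i)
    iteratedSum-1 zero    = 0-homo
    iteratedSum-1 (suc k) = begin
      -- `iteratedSum` adds the last power while `sum` splits off the first one. With S the sum so
      -- far, q^k = 1 + t S turns S + q^k into 1 + q S.
      iteratedSum 1 k + q ^ k                    ≈⟨ +-congˡ (iteratedSum-step 0 k) ⟩
      iteratedSum 1 k + (⟨ 1 ⟩ + t * iteratedSum 1 k)
        ≈⟨ solve 2 (λ B t → B :+ (⟪ 1 ⟫ :+ t :* B) := ⟪ 1 ⟫ :+ (⟪ 1 ⟫ :+ t) :* B) ≈-refl _ t ⟩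
      ⟨ 1 ⟩ + (⟨ 1 ⟩ + t) * iteratedSum 1 k      ≈⟨ +-cong 1-homo (*-cong (≈-sym q≈1+3u) (iteratedSum-1 k)) ⟩
      1# + q * sum {k} (λ i → q ^ toℕ i)         ≈⟨ +-congˡ (*-distribˡ-sum {k} q (λ i → q ^ toℕ i)) ⟩
      1# + sum {k} (λ i → q * q ^ toℕ i)         ∎

    binomialSum : ℕ → ℕ → Carrier
    binomialSum zero    k = ⟨ 0 ⟩
    binomialSum (suc j) k = binomialSum j k + t ^ j * binomial k (2 ℕ.+ j)

    iteratedSum-2 : ∀ j k → iteratedSum 2 k ≈ binomialSum j k + t ^ j * iteratedSum (2 ℕ.+ j) k
    iteratedSum-2 zero    k = ≈-trans (solve 1 (λ B → B := ⟪ 0 ⟫ :+ ⟪ 1 ⟫ :* B) ≈-refl _) (+-congˡ (*-congʳ 1-homo))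
    iteratedSum-2 (suc j) k = begin
      iteratedSum 2 k                                             ≈⟨ iteratedSum-2 j k ⟩
      binomialSum j k + t ^ j * iteratedSum (2 ℕ.+ j) k
        ≈⟨ +-congˡ (*-congˡ (iteratedSum-step (2 ℕ.+ j) k)) ⟩
      binomialSum j k + t ^ j * (binomial k (2 ℕ.+ j) + t * iteratedSum (3 ℕ.+ j) k)
        ≈⟨ solve 5 (λ s p b t B → s :+ p :* (b :+ t :* B) := s :+ p :* b :+ t :* p :* B) ≈-refl _ _ _ _ _ ⟩
      binomialSum j k + t ^ j * binomial k (2 ℕ.+ j) + t * t ^ j * iteratedSum (3 ℕ.+ j) k ∎

    t^≈3^*u^ : ∀ i → t ^ i ≈ 3^ i * u ^ i
    t^≈3^*u^ zero    = ≈-trans (≈-sym (*-identityˡ 1#)) (*-congʳ (≈-sym 1-homo))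
    t^≈3^*u^ (suc i) = begin
      ⟨ 3 ⟩ * u * t ^ i               ≈⟨ *-congˡ (t^≈3^*u^ i) ⟩
      ⟨ 3 ⟩ * u * (3^ i * u ^ i)
        ≈⟨ solve 4 (λ a u p v → a :* u :* (p :* v) := a :* p :* (u :* v)) ≈-refl _ _ _ _ ⟩
      ⟨ 3 ⟩ * 3^ i * (u * u ^ i)      ≈⟨ *-congʳ (3^-suc i) ⟨
      3^ (suc i) * (u * u ^ i)        ∎

    -- Twice C(z, 2) + t C(z, 3), divided by z (z - 1), is 1 + u (z - 2); E collects the later
    -- terms.
    cofactor : Carrier → (Carrier → Carrier) → Carrier → Carrier
    cofactor M E z = M * (⟨ 1 ⟩ + u * (z - ⟨ 2 ⟩)) + ⟨ 3 ⟩ * E z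

    -- A new term t^(2 + j) C(k, 4 + j) requires a further multiplier a, with w (4 + j)! = 3^(1 + j)
    -- a. Multiplication by a turns 3^(1 + j) C(k, 4 + j) into w times a falling factorial, and t^(2
    -- + j) still has a factor 3 to spare.
    factorisation : ∀ j → ∃[ M ] ∃[ E ] PrincipalUnit M × Lip E × (∀ k →
      ⟨ 2 ⟩ * M * binomialSum (2 ℕ.+ j) k ≈ ⟨ k ⟩ * (⟨ k ⟩ - ⟨ 1 ⟩) * cofactor M E ⟨ k ⟩)
    factorisation zero = ⟨ 1 ⟩ , (λ _ → ⟨ 0 ⟩) ,
      (⟨ 0 ⟩ , solve 0 (⟪ 0 ⟫ :* ⟪ 3 ⟫ := ⟪ 1 ⟫ :- ⟪ 1 ⟫) ≈-refl) , Lip-const ⟨ 0 ⟩ , λ k → begin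
        ⟨ 2 ⟩ * ⟨ 1 ⟩ * (⟨ 0 ⟩ + 1# * binomial k 2 + t * 1# * binomial k 3)
          ≈⟨ *-congˡ (+-cong (+-congˡ (*-congʳ (≈-sym 1-homo))) (*-congʳ (*-congˡ (≈-sym 1-homo)))) ⟩
        ⟨ 2 ⟩ * ⟨ 1 ⟩ * (⟨ 0 ⟩ + ⟨ 1 ⟩ * binomial k 2 + t * ⟨ 1 ⟩ * binomial k 3)
          ≈⟨ solve 3 (λ a b u → ⟪ 2 ⟫ :* ⟪ 1 ⟫ :* (⟪ 0 ⟫ :+ ⟪ 1 ⟫ :* a :+ ⟪ 3 ⟫ :* u :* ⟪ 1 ⟫ :* b) :=
               ⟪ 2 ⟫ :* (⟪ 1 ⟫ :* ⟪ 1 ⟫) :* a :+ u :* (⟪ 3 ⟫ :* (⟪ 2 ⟫ :* (⟪ 1 ⟫ :* ⟪ 1 ⟫)) :* b)) ≈-refl _ _ u ⟩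
        factorial 2 * binomial k 2 + u * (factorial 3 * binomial k 3)
          ≈⟨ +-cong (factorial*binomial k 2) (*-congˡ (factorial*binomial k 3)) ⟩
        fallingFactorial ⟨ k ⟩ 2 + u * fallingFactorial ⟨ k ⟩ 3
          ≈⟨ solve 2 (λ z u →
               let f₂ = ⟪ 1 ⟫ :* (z :- ⟪ 0 ⟫) :* (z :- ⟪ 1 ⟫) in
               f₂ :+ u :* (f₂ :* (z :- ⟪ 2 ⟫)) :=
               z :* (z :- ⟪ 1 ⟫) :* (⟪ 1 ⟫ :* (⟪ 1 ⟫ :+ u :* (z :- ⟪ 2 ⟫)) :+ ⟪ 3 ⟫ :* ⟪ 0 ⟫)) ≈-refl ⟨ k ⟩ u ⟩
        ⟨ k ⟩ * (⟨ k ⟩ - ⟨ 1 ⟩) * cofactor ⟨ 1 ⟩ (λ _ → ⟨ 0 ⟩) ⟨ k ⟩ ∎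
    factorisation (suc j) with factorisation j | factorial-val≤ j
    ... | M , E , M-unit , E-lip , eq | a , a-unit , (w , wf≈3ʲa) =
      M * a , (λ z → a * E z + ⟨ 2 ⟩ * M * v * w * fallingFactorialFrom2 z (2 ℕ.+ j)) ,
      PrincipalUnit-* M-unit a-unit ,
      Lip-+ (Lip-* (Lip-const a) E-lip)
            (Lip-* (Lip-const (⟨ 2 ⟩ * M * v * w)) (Lip-fallingFactorialFrom2 (2 ℕ.+ j))) ,
      λ k → begin
        ⟨ 2 ⟩ * (M * a) * (binomialSum (2 ℕ.+ j) k + t ^ (2 ℕ.+ j) * binomial k (4 ℕ.+ j))
          ≈⟨ *-congˡ (+-congˡ (*-congʳ (≈-trans (t^≈3^*u^ (2 ℕ.+ j)) (*-congʳ (3^-suc (1 ℕ.+ j)))))) ⟩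
        ⟨ 2 ⟩ * (M * a) * (binomialSum (2 ℕ.+ j) k + ⟨ 3 ⟩ * 3^ (1 ℕ.+ j) * v * binomial k (4 ℕ.+ j))
          ≈⟨ solve 6 (λ M a S p v b →
               ⟪ 2 ⟫ :* (M :* a) :* (S :+ ⟪ 3 ⟫ :* p :* v :* b) :=
               a :* (⟪ 2 ⟫ :* M :* S) :+ ⟪ 2 ⟫ :* M :* ⟪ 3 ⟫ :* v :* b :* (p :* a)) ≈-refl M a _ _ v _ ⟩
        a * (⟨ 2 ⟩ * M * binomialSum (2 ℕ.+ j) k) + ⟨ 2 ⟩ * M * ⟨ 3 ⟩ * v * binomial k (4 ℕ.+ j) * (3^ (1 ℕ.+ j) * a)
          ≈⟨ +-cong (*-congˡ (eq k)) (*-congˡ (≈-sym wf≈3ʲa)) ⟩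
        a * (⟨ k ⟩ * (⟨ k ⟩ - ⟨ 1 ⟩) * cofactor M E ⟨ k ⟩)
          + ⟨ 2 ⟩ * M * ⟨ 3 ⟩ * v * binomial k (4 ℕ.+ j) * (w * factorial (4 ℕ.+ j))
          ≈⟨ solve 6 (λ X M v b w f →
               X :+ ⟪ 2 ⟫ :* M :* ⟪ 3 ⟫ :* v :* b :* (w :* f) := X :+ ⟪ 2 ⟫ :* M :* ⟪ 3 ⟫ :* v :* w :* (f :* b))
                 ≈-refl _ M v _ w _ ⟩
        a * (⟨ k ⟩ * (⟨ k ⟩ - ⟨ 1 ⟩) * cofactor M E ⟨ k ⟩)
          + ⟨ 2 ⟩ * M * ⟨ 3 ⟩ * v * w * (factorial (4 ℕ.+ j) * binomial k (4 ℕ.+ j))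
          ≈⟨ +-congˡ (*-congˡ (≈-trans (factorial*binomial k (4 ℕ.+ j)) (fallingFactorial-2+ ⟨ k ⟩ (2 ℕ.+ j)))) ⟩
        a * (⟨ k ⟩ * (⟨ k ⟩ - ⟨ 1 ⟩) * cofactor M E ⟨ k ⟩)
          + ⟨ 2 ⟩ * M * ⟨ 3 ⟩ * v * w * (⟨ k ⟩ * (⟨ k ⟩ - ⟨ 1 ⟩) * fallingFactorialFrom2 ⟨ k ⟩ (2 ℕ.+ j))
          ≈⟨ solve 8 (λ M a v w z u e g →
               a :* (z :* (z :- ⟪ 1 ⟫) :* (M :* (⟪ 1 ⟫ :+ u :* (z :- ⟪ 2 ⟫)) :+ ⟪ 3 ⟫ :* e))
                 :+ ⟪ 2 ⟫ :* M :* ⟪ 3 ⟫ :* v :* w :* (z :* (z :- ⟪ 1 ⟫) :* g) :=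
               z :* (z :- ⟪ 1 ⟫) :* (M :* a :* (⟪ 1 ⟫ :+ u :* (z :- ⟪ 2 ⟫))
                 :+ ⟪ 3 ⟫ :* (a :* e :+ ⟪ 2 ⟫ :* M :* v :* w :* g))) ≈-refl M a v w ⟨ k ⟩ u (E ⟨ k ⟩) _ ⟩
        ⟨ k ⟩ * (⟨ k ⟩ - ⟨ 1 ⟩) * cofactor (M * a) (λ z → a * E z + ⟨ 2 ⟩ * M * v * w * fallingFactorialFrom2 z (2 ℕ.+ j)) ⟨ k ⟩ ∎
      where
      v : Carrier
      v = u ^ (2 ℕ.+ j)

    cofactor-slope : ∀ {M E} → PrincipalUnit M → Lip E → ∀ x y →
      ∃[ s ] ⟨ 3 ⟩ ∣ s - u × cofactor M E x - cofactor M E y ≈ (x - y) * s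
    cofactor-slope {M} {E} M-unit E-lip x y with E-lip x y
    ... | r , e = M * u + ⟨ 3 ⟩ * r ,
      ∣-combine u r (solve 3 (λ M u r → M :* u :+ ⟪ 3 ⟫ :* r :- u := u :* (M :- ⟪ 1 ⟫) :+ r :* ⟪ 3 ⟫)
        ≈-refl M u r) M-unit ∣ʳ-refl ,
      (begin
        cofactor M E x - cofactor M E y
          ≈⟨ solve 6 (λ M u x y a b →
               M :* (⟪ 1 ⟫ :+ u :* (x :- ⟪ 2 ⟫)) :+ ⟪ 3 ⟫ :* a :- (M :* (⟪ 1 ⟫ :+ u :* (y :- ⟪ 2 ⟫)) :+ ⟪ 3 ⟫ :* b) :=
               (x :- y) :* (M :* u) :+ ⟪ 3 ⟫ :* (a :- b)) ≈-refl M u x y (E x) (E y) ⟩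
        (x - y) * (M * u) + ⟨ 3 ⟩ * (E x - E y)
          ≈⟨ +-congˡ (*-congˡ (≈-sym e)) ⟩
        (x - y) * (M * u) + ⟨ 3 ⟩ * (r * (x - y))
          ≈⟨ solve 4 (λ d M u r → d :* (M :* u) :+ ⟪ 3 ⟫ :* (r :* d) := d :* (M :* u :+ ⟪ 3 ⟫ :* r))
            ≈-refl (x - y) M u r ⟩
        (x - y) * (M * u + ⟨ 3 ⟩ * r) ∎)

    module _
      (3∤u : ⟨ 3 ⟩ ∤ u)
      (f : Carrier → Carrier)
      (continuous : ∀ x n → ∃[ m ] (∀ y → 3^ m ∣ y - x → 3^ n ∣ f y - f x))
      (interpolates : ∀ k → f ⟨ k ⟩ ≈ sum {k} (λ i → q ^ toℕ i))
      (N : ℕ)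
      where

      interpolation : ∀ k → f ⟨ k ⟩ - ⟨ k ⟩ ≈ t * iteratedSum 2 k
      interpolation k = begin
        f ⟨ k ⟩ - ⟨ k ⟩
          ≈⟨ +-congʳ (≈-trans (interpolates k) (≈-sym (iteratedSum-1 k))) ⟩
        iteratedSum 1 k - ⟨ k ⟩                        ≈⟨ +-congʳ (iteratedSum-step 1 k) ⟩
        binomial k 1 + t * iteratedSum 2 k - ⟨ k ⟩     ≈⟨ +-congʳ (+-congʳ (binomial-1 k)) ⟩
        ⟨ k ⟩ + t * iteratedSum 2 k - ⟨ k ⟩            ≈⟨ solve 2 (λ k b → k :+ b :- k := b) ≈-refl _ _ ⟩
        t * iteratedSum 2 k                            ∎

      module _ {M : Carrier} {E : Carrier → Carrier} (M-unit : PrincipalUnit M) (E-lip : Lip E)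
        (factorised : ∀ k →
          ⟨ 2 ⟩ * M * binomialSum (2 ℕ.+ N) k ≈ ⟨ k ⟩ * (⟨ k ⟩ - ⟨ 1 ⟩) * cofactor M E ⟨ k ⟩)
        where

        G : Carrier → Carrier
        G z = z * (z - ⟨ 1 ⟩) * cofactor M E z

        G-lip : Lip G
        G-lip = Lip-* (Lip-* Lip-id (Lip-+ Lip-id (Lip-const (- ⟨ 1 ⟩))))
          (Lip-+ (Lip-* (Lip-const M) (Lip-+ (Lip-const ⟨ 1 ⟩) (Lip-* (Lip-const u) (Lip-+ Lip-id (Lip-const (- ⟨ 2 ⟩))))))
                 (Lip-* (Lip-const ⟨ 3 ⟩) E-lip))

        -- The difference is exactly the truncation remainder, a multiple of t^(3 + N) and hence of
        -- 3^(N + 1).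
        3^∣displacement-ℕ : ∀ k → 3^ (suc N) ∣ ⟨ 2 ⟩ * M * (f ⟨ k ⟩ - ⟨ k ⟩) - t * G ⟨ k ⟩
        3^∣displacement-ℕ k = ∣-scale (⟨ 2 ⟩ * M * t * (⟨ 3 ⟩ * (u ^ (2 ℕ.+ N))) * iteratedSum (4 ℕ.+ N) k) (begin
          ⟨ 2 ⟩ * M * (f ⟨ k ⟩ - ⟨ k ⟩) - t * G ⟨ k ⟩
            ≈⟨ +-cong (*-congˡ (≈-trans (interpolation k) (*-congˡ (iteratedSum-2 (2 ℕ.+ N) k)))) (-‿cong (*-congˡ (≈-sym (factorised k)))) ⟩
          ⟨ 2 ⟩ * M * (t * (binomialSum (2 ℕ.+ N) k + t ^ (2 ℕ.+ N) * iteratedSum (4 ℕ.+ N) k))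
            - t * (⟨ 2 ⟩ * M * binomialSum (2 ℕ.+ N) k)
            ≈⟨ solve 5 (λ M t S p B → ⟪ 2 ⟫ :* M :* (t :* (S :+ p :* B)) :- t :* (⟪ 2 ⟫ :* M :* S) :=
              ⟪ 2 ⟫ :* M :* t :* p :* B)
              ≈-refl M t _ _ _ ⟩
          ⟨ 2 ⟩ * M * t * t ^ (2 ℕ.+ N) * iteratedSum (4 ℕ.+ N) k
            ≈⟨ *-congʳ (*-congˡ (≈-trans (t^≈3^*u^ (2 ℕ.+ N)) (*-congʳ (3^-suc (1 ℕ.+ N))))) ⟩
          ⟨ 2 ⟩ * M * t * (⟨ 3 ⟩ * 3^ (1 ℕ.+ N) * u ^ (2 ℕ.+ N)) * iteratedSum (4 ℕ.+ N) k
            ≈⟨ solve 5 (λ M t p v B → ⟪ 2 ⟫ :* M :* t :* (⟪ 3 ⟫ :* p :* v) :* B :=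
              ⟪ 2 ⟫ :* M :* t :* (⟪ 3 ⟫ :* v) :* B :* p)
              ≈-refl M t _ _ _ ⟩
          ⟨ 2 ⟩ * M * t * (⟨ 3 ⟩ * u ^ (2 ℕ.+ N)) * iteratedSum (4 ℕ.+ N) k * 3^ (suc N) ∎) ∣ʳ-refl

        3^∣displacement : ∀ z → 3^ (suc N) ∣ ⟨ 2 ⟩ * M * (f z - z) - t * G z
        3^∣displacement z with continuous z (suc N)
        -- The natural number k must be close enough to z for both continuity of f, which needs m,
        -- and the Lipschitz bound on G, which needs N + 1.
        ... | m , cont with dense (m ℕ.+ suc N) z
        ... | k , k≡z = ∣-≡mod (3^∣displacement-ℕ k)
          (∣-combine (- (⟨ 2 ⟩ * M)) ⟨ 1 ⟩
            (solve 8 (λ M t fk k gk fz z gz →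
              ⟪ 2 ⟫ :* M :* (fz :- z) :- t :* gz :- (⟪ 2 ⟫ :* M :* (fk :- k) :- t :* gk) :=
              :- (⟪ 2 ⟫ :* M) :* (fk :- fz) :+ ⟪ 1 ⟫ :* (⟪ 2 ⟫ :* M :* (k :- z) :+ t :* (gk :- gz)))
              ≈-refl M t (f ⟨ k ⟩) ⟨ k ⟩ (G ⟨ k ⟩) (f z) z (G z))
            (cont ⟨ k ⟩ (3^-mono (ℕₚ.m≤m+n m (suc N)) k≡z))
            (∣-combine (⟨ 2 ⟩ * M) t ≈-refl k≡z′ (∣ʳ-trans k≡z′ (G-lip ⟨ k ⟩ z))))
          where
          k≡z′ : 3^ (suc N) ∣ ⟨ k ⟩ - z
          k≡z′ = 3^-mono (ℕₚ.m≤n+m (suc N) m) k≡z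

        3^∣t*⇒ : ∀ x → 3^ (suc N) ∣ t * x → 3^ N ∣ x
        3^∣t*⇒ x d = 3∤-cancelˡ N x 3∤u (3^-cancelˡ 1 N (u * x) (∣-scale ⟨ 1 ⟩
          (solve 2 (λ u x → ⟪ 3 ⟫ :* (u :* x) := ⟪ 1 ⟫ :* (⟪ 3 ⟫ :* u :* x)) ≈-refl u x) d))

        fixed⇒ : ∀ {z} → Fixed f (suc N) z → 3^ N ∣ G z
        fixed⇒ {z} d = 3^∣t*⇒ (G z) (∣-combine (⟨ 2 ⟩ * M) (- ⟨ 1 ⟩)
          (solve 4 (λ M d t g → t :* g := ⟪ 2 ⟫ :* M :* d :+ :- ⟪ 1 ⟫ :* (⟪ 2 ⟫ :* M :* d :- t :* g))
            ≈-refl M (f z - z) t (G z))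
          d (3^∣displacement z))

        fixed⇐ : ∀ {z} → 3^ N ∣ G z → 3^ (suc N) ∣ f z - z
        fixed⇐ {z} d = 3∤-cancelˡ (suc N) (f z - z) (3∤-* 3∤2 (≡1⇒3∤ M-unit))
          (∣-combine ⟨ 1 ⟩ u
            (solve 4 (λ M d u g → ⟪ 2 ⟫ :* M :* d :=
              ⟪ 1 ⟫ :* (⟪ 2 ⟫ :* M :* d :- ⟪ 3 ⟫ :* u :* g) :+ u :* (⟪ 3 ⟫ :* g)) ≈-refl M (f z - z) u (G z))
            (3^∣displacement z) (3^-∣* 1 N ∣ʳ-refl d))

      fixedPointEquation : FixedPointEquation u f N
      fixedPointEquation with factorisation N
      ... | M , E , M-unit , E-lip , eq = record
        { F        = cofactor M E
        ; slope    = cofactor-slope M-unit E-lip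
        ; F[2]≡1   = ∣-combine ⟨ 1 ⟩ (E ⟨ 2 ⟩)
            (solve 3 (λ M u e → M :* (⟪ 1 ⟫ :+ u :* (⟪ 2 ⟫ :- ⟪ 2 ⟫)) :+ ⟪ 3 ⟫ :* e :- ⟪ 1 ⟫ :=
              ⟪ 1 ⟫ :* (M :- ⟪ 1 ⟫) :+ e :* ⟪ 3 ⟫) ≈-refl M u (E ⟨ 2 ⟩)) M-unit ∣ʳ-refl
        ; sound    = fixed⇒ M-unit E-lip eq
        ; complete = fixed⇐ M-unit E-lip eq
        }

  HasVal-resp : ∀ m {x y} → x ≈ y → HasVal x m → HasVal y m
  HasVal-resp m e (d , d∤) = ∣ʳ-respʳ-≈ e d , λ d′ → d∤ (∣ʳ-respʳ-≈ (≈-sym e) d′)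

  -- Fixed points for u ≡ 2 and, by reflection, for u ≡ 1 modulo 3

  module FixedPoints
    {u : Carrier} {f : Carrier → Carrier} {N : ℕ} (equation : FixedPointEquation u f N) (1≤N : 1 ≤ N)
    (z₀ : Carrier) (v₀ : ℕ)
    (fixed : Fixed f (suc N) z₀) (valuation : HasVal (z₀ * (z₀ - ⟨ 1 ⟩)) v₀) (nonzero : v₀ ≢ 0)
    (minimal : ∀ z m → Fixed f (suc N) z → HasVal (z * (z - ⟨ 1 ⟩)) m → m ≢ 0 → v₀ ≤ m)
    where
    open FixedPointEquation equation

    module Case7 (3∣u-2 : ⟨ 3 ⟩ ∣ u - ⟨ 2 ⟩) where
      slope+1 : ∀ x y → ∃[ s ] ⟨ 3 ⟩ ∣ s + ⟨ 1 ⟩ × F x - F y ≈ (x - y) * s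
      slope+1 x y with slope x y
      ... | s , d , e = s , ∣-combine ⟨ 1 ⟩ ⟨ 1 ⟩
        (solve 2 (λ s u → s :+ ⟪ 1 ⟫ := ⟪ 1 ⟫ :* (s :- u) :+ ⟪ 1 ⟫ :* (⟪ 1 ⟫ :* (u :- ⟪ 2 ⟫) :+ ⟪ 1 ⟫ :* ⟪ 3 ⟫))
          ≈-refl s u)
        d (∣-combine ⟨ 1 ⟩ ⟨ 1 ⟩ ≈-refl 3∣u-2 ∣ʳ-refl) , e

      -- F(0) = F(2) - 2 s ≡ 1 + 2 (mod 3), since s ≡ -1.
      3∣F0 : ⟨ 3 ⟩ ∣ F ⟨ 0 ⟩
      3∣F0 = let s , d , e = slope+1 ⟨ 2 ⟩ ⟨ 0 ⟩ in ∣-combine ⟨ 1 ⟩ ⟨ 1 ⟩ (begin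
        F ⟨ 0 ⟩                                      ≈⟨ solve 2 (λ a b → b := a :- (a :- b)) ≈-refl (F ⟨ 2 ⟩) _ ⟩
        F ⟨ 2 ⟩ - (F ⟨ 2 ⟩ - F ⟨ 0 ⟩)                ≈⟨ +-congˡ (-‿cong e) ⟩
        F ⟨ 2 ⟩ - (⟨ 2 ⟩ - ⟨ 0 ⟩) * s
          ≈⟨ solve 2 (λ a s → a :- (⟪ 2 ⟫ :- ⟪ 0 ⟫) :* s :=
            ⟪ 1 ⟫ :* (a :- ⟪ 1 ⟫) :+ ⟪ 1 ⟫ :* (⟪ 1 ⟫ :* ⟪ 3 ⟫ :+ :- ⟪ 2 ⟫ :* (s :+ ⟪ 1 ⟫)))
            ≈-refl (F ⟨ 2 ⟩) s ⟩
        ⟨ 1 ⟩ * (F ⟨ 2 ⟩ - ⟨ 1 ⟩) + ⟨ 1 ⟩ * (⟨ 1 ⟩ * ⟨ 3 ⟩ + - ⟨ 2 ⟩ * (s + ⟨ 1 ⟩)) ∎)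
        F[2]≡1 (∣-combine ⟨ 1 ⟩ (- ⟨ 2 ⟩) ≈-refl ∣ʳ-refl d)

      open Core.Minimal F slope+1 3∣F0 N 1≤N z₀ v₀ (sound fixed) valuation nonzero
        (λ z m root → minimal z m (complete root))

      small : v₀ ℕ.+ v₀ < N → ∀ {z} →
        (Fixed f (suc N) z → 3^ (N ∸ v₀) ∣ z - z₀ ⊎ 3^ (N ∸ v₀) ∣ z ⊎ 3^ N ∣ z - ⟨ 1 ⟩) ×
        (3^ (N ∸ v₀) ∣ z - z₀ ⊎ 3^ (N ∸ v₀) ∣ z ⊎ 3^ N ∣ z - ⟨ 1 ⟩ → Fixed f (suc N) z)
      small lt = (λ fx → Small.only lt (sound fx)) , (λ d → complete (Small.all lt d))

      large : N ≤ v₀ ℕ.+ v₀ → ∀ {z} →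
        (Fixed f (suc N) z → 3^ ⌊ suc N /2⌋ ∣ z ⊎ 3^ N ∣ z - ⟨ 1 ⟩) ×
        (3^ ⌊ suc N /2⌋ ∣ z ⊎ 3^ N ∣ z - ⟨ 1 ⟩ → Fixed f (suc N) z)
      large le = (λ fx → Large.only le (sound fx)) , (λ d → complete (Large.all le d))

    module Case4 (3∣u-1 : ⟨ 3 ⟩ ∣ u - ⟨ 1 ⟩) where
      slope-1 : ∀ x y → ∃[ s ] ⟨ 3 ⟩ ∣ s - ⟨ 1 ⟩ × F x - F y ≈ (x - y) * s
      slope-1 x y with slope x y
      ... | s , d , e = s , ∣-combine ⟨ 1 ⟩ ⟨ 1 ⟩
        (solve 2 (λ s u → s :- ⟪ 1 ⟫ := ⟪ 1 ⟫ :* (s :- u) :+ ⟪ 1 ⟫ :* (u :- ⟪ 1 ⟫)) ≈-refl s u) d 3∣u-1 , e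

      -- F is an arbitrary map of carriers, so its compatibility with `_≈_` has to come from the
      -- slope identity.
      F-cong : ∀ {x y} → x ≈ y → F x ≈ F y
      F-cong {x} {y} x≈y with slope x y
      ... | s , _ , e = begin
        F x                    ≈⟨ solve 2 (λ a b → a := a :- b :+ b) ≈-refl (F x) (F y) ⟩
        F x - F y + F y        ≈⟨ +-congʳ (≈-trans e (*-congʳ (+-congʳ x≈y))) ⟩
        (y - y) * s + F y      ≈⟨ solve 3 (λ y s b → (y :- y) :* s :+ b := b) ≈-refl y s (F y) ⟩
        F y                    ∎

      -- The reflection z ↦ 1 - z exchanges the roots 0 and 1 and negates the slope; it takes ι_q to ι_{1/q}.
      F′ : Carrier → Carrier
      F′ z = F (⟨ 1 ⟩ - z)

      slope′ : ∀ x y → ∃[ s ] ⟨ 3 ⟩ ∣ s + ⟨ 1 ⟩ × F′ x - F′ y ≈ (x - y) * s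
      slope′ x y = let s , d , e = slope-1 (⟨ 1 ⟩ - x) (⟨ 1 ⟩ - y) in
        - s , ∣-scale (- ⟨ 1 ⟩) (solve 1 (λ s → :- s :+ ⟪ 1 ⟫ :=
        :- ⟪ 1 ⟫ :* (s :- ⟪ 1 ⟫))
        ≈-refl s) d ,
        ≈-trans e (solve 3 (λ x y s → (⟪ 1 ⟫ :- x :- (⟪ 1 ⟫ :- y)) :* s := (x :- y) :* :- s) ≈-refl x y s)

      -- F(1) = F(2) - s ≡ 1 - 1 (mod 3), since s ≡ 1.
      3∣F′0 : ⟨ 3 ⟩ ∣ F′ ⟨ 0 ⟩
      3∣F′0 = let s , d , e = slope-1 ⟨ 2 ⟩ (⟨ 1 ⟩ - ⟨ 0 ⟩) in ∣-combine ⟨ 1 ⟩ (- ⟨ 1 ⟩) (begin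
        F′ ⟨ 0 ⟩                                     ≈⟨ solve 2 (λ a b → b := a :- (a :- b)) ≈-refl (F ⟨ 2 ⟩) _ ⟩
        F ⟨ 2 ⟩ - (F ⟨ 2 ⟩ - F′ ⟨ 0 ⟩)               ≈⟨ +-congˡ (-‿cong e) ⟩
        F ⟨ 2 ⟩ - (⟨ 2 ⟩ - (⟨ 1 ⟩ - ⟨ 0 ⟩)) * s
          ≈⟨ solve 2 (λ a s → a :- (⟪ 2 ⟫ :- (⟪ 1 ⟫ :- ⟪ 0 ⟫)) :* s :=
            ⟪ 1 ⟫ :* (a :- ⟪ 1 ⟫) :+ :- ⟪ 1 ⟫ :* (s :- ⟪ 1 ⟫))
            ≈-refl (F ⟨ 2 ⟩) s ⟩
        ⟨ 1 ⟩ * (F ⟨ 2 ⟩ - ⟨ 1 ⟩) + - ⟨ 1 ⟩ * (s - ⟨ 1 ⟩) ∎)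
        F[2]≡1 d

      open Core F′ slope′ 3∣F′0 N using (Root)

      reflect-product : ∀ z → z * (z - ⟨ 1 ⟩) ≈ (⟨ 1 ⟩ - z) * (⟨ 1 ⟩ - z - ⟨ 1 ⟩)
      reflect-product = solve 1 (λ z → z :* (z :- ⟪ 1 ⟫) := (⟪ 1 ⟫ :- z) :* (⟪ 1 ⟫ :- z :- ⟪ 1 ⟫)) ≈-refl

      reflect-twice : ∀ z → z ≈ ⟨ 1 ⟩ - (⟨ 1 ⟩ - z)
      reflect-twice = solve 1 (λ z → z := ⟪ 1 ⟫ :- (⟪ 1 ⟫ :- z)) ≈-refl

      Fixed⇒Root : ∀ {z} → Fixed f (suc N) z → Root (⟨ 1 ⟩ - z)
      Fixed⇒Root {z} fx = ∣ʳ-respʳ-≈ (*-cong (reflect-product z) (F-cong (reflect-twice z))) (sound fx)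

      Root⇒Fixed : ∀ {z} → Root z → Fixed f (suc N) (⟨ 1 ⟩ - z)
      Root⇒Fixed {z} root = complete (∣ʳ-respʳ-≈ (*-congʳ (reflect-product z)) root)

      Root⇒Fixed′ : ∀ {z} → Root (⟨ 1 ⟩ - z) → Fixed f (suc N) z
      Root⇒Fixed′ {z} root = complete (∣ʳ-respʳ-≈
        (≈-sym (*-cong (reflect-product z) (F-cong (reflect-twice z)))) root)

      open Core.Minimal F′ slope′ 3∣F′0 N 1≤N (⟨ 1 ⟩ - z₀) v₀
        (Fixed⇒Root fixed) (HasVal-resp v₀ (reflect-product z₀) valuation) nonzero
        (λ z m root val → minimal (⟨ 1 ⟩ - z) m (Root⇒Fixed root) (HasVal-resp m (reflect-product z) val))

      flip-diff : ∀ k {z w} → 3^ k ∣ ⟨ 1 ⟩ - z - (⟨ 1 ⟩ - w) → 3^ k ∣ z - w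
      flip-diff k {z} {w} = ∣-scale (- ⟨ 1 ⟩)
        (solve 2 (λ z w → z :- w := :- ⟪ 1 ⟫ :* (⟪ 1 ⟫ :- z :- (⟪ 1 ⟫ :- w))) ≈-refl z w)

      flip-diff⁻ : ∀ k {z w} → 3^ k ∣ z - w → 3^ k ∣ ⟨ 1 ⟩ - z - (⟨ 1 ⟩ - w)
      flip-diff⁻ k {z} {w} = ∣-scale (- ⟨ 1 ⟩)
        (solve 2 (λ z w → ⟪ 1 ⟫ :- z :- (⟪ 1 ⟫ :- w) := :- ⟪ 1 ⟫ :* (z :- w)) ≈-refl z w)

      flip-0 : ∀ k {z} → 3^ k ∣ ⟨ 1 ⟩ - z → 3^ k ∣ z - ⟨ 1 ⟩
      flip-0 k {z} = ∣-scale (- ⟨ 1 ⟩) (solve 1 (λ z → z :- ⟪ 1 ⟫ := :- ⟪ 1 ⟫ :* (⟪ 1 ⟫ :- z)) ≈-refl z)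

      flip-0⁻ : ∀ k {z} → 3^ k ∣ z - ⟨ 1 ⟩ → 3^ k ∣ ⟨ 1 ⟩ - z
      flip-0⁻ k {z} = ∣-scale (- ⟨ 1 ⟩) (solve 1 (λ z → ⟪ 1 ⟫ :- z := :- ⟪ 1 ⟫ :* (z :- ⟪ 1 ⟫)) ≈-refl z)

      flip-1 : ∀ k {z} → 3^ k ∣ ⟨ 1 ⟩ - z - ⟨ 1 ⟩ → 3^ k ∣ z
      flip-1 k {z} = ∣-scale (- ⟨ 1 ⟩) (solve 1 (λ z → z := :- ⟪ 1 ⟫ :* (⟪ 1 ⟫ :- z :- ⟪ 1 ⟫)) ≈-refl z)

      flip-1⁻ : ∀ k {z} → 3^ k ∣ z → 3^ k ∣ ⟨ 1 ⟩ - z - ⟨ 1 ⟩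
      flip-1⁻ k {z} = ∣-scale (- ⟨ 1 ⟩) (solve 1 (λ z → ⟪ 1 ⟫ :- z :- ⟪ 1 ⟫ := :- ⟪ 1 ⟫ :* z) ≈-refl z)

      small : v₀ ℕ.+ v₀ < N → ∀ {z} →
        (Fixed f (suc N) z → 3^ (N ∸ v₀) ∣ z - z₀ ⊎ 3^ (N ∸ v₀) ∣ z - ⟨ 1 ⟩ ⊎ 3^ N ∣ z) ×
        (3^ (N ∸ v₀) ∣ z - z₀ ⊎ 3^ (N ∸ v₀) ∣ z - ⟨ 1 ⟩ ⊎ 3^ N ∣ z → Fixed f (suc N) z)
      small lt =
        (λ fx → Sum.map (flip-diff (N ∸ v₀)) (Sum.map (flip-0 (N ∸ v₀)) (flip-1 N)) (Small.only lt (Fixed⇒Root fx))) ,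
        (λ d → Root⇒Fixed′ (Small.all lt (Sum.map (flip-diff⁻ (N ∸ v₀)) (Sum.map (flip-0⁻ (N ∸ v₀)) (flip-1⁻ N)) d)))

      large : N ≤ v₀ ℕ.+ v₀ → ∀ {z} →
        (Fixed f (suc N) z → 3^ ⌊ suc N /2⌋ ∣ z - ⟨ 1 ⟩ ⊎ 3^ N ∣ z) ×
        (3^ ⌊ suc N /2⌋ ∣ z - ⟨ 1 ⟩ ⊎ 3^ N ∣ z → Fixed f (suc N) z)
      large le =
        (λ fx → Sum.map (flip-0 ⌊ suc N /2⌋) (flip-1 N) (Large.only le (Fixed⇒Root fx))) ,
        (λ d → Root⇒Fixed′ (Large.all le (Sum.map (flip-0⁻ ⌊ suc N /2⌋) (flip-1⁻ N) d)))

  -- Translation of the divisibility conditions into cosets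

  module _
    (q : Carrier) (q≡1 : Coset 1# 3 q)
    (f : Carrier → Carrier)
    (continuous : ∀ x n → ∃[ m ] (∀ y → 3^ m ∣ y - x → 3^ n ∣ f y - f x))
    (interpolates : ∀ k → f ⟨ k ⟩ ≈ sum {k} (λ i → q ^ toℕ i))
    (N : ℕ) (1≤N : 1 ≤ N)
    (z₀ : Carrier) (v₀ : ℕ)
    (fixed : Fixed f (suc N) z₀) (valuation : HasVal (z₀ * (z₀ - ⟨ 1 ⟩)) v₀) (nonzero : v₀ ≢ 0)
    (minimal : ∀ z m → Fixed f (suc N) z → HasVal (z * (z - ⟨ 1 ⟩)) m → m ≢ 0 → v₀ ≤ m)
    where

    private
      n τ : ℕ
      n = suc N
      τ = 3 ℕ.^ (n ∸ v₀ ∸ 1)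

      τ≡3^[N∸v₀] : τ ≡ 3 ℕ.^ (N ∸ v₀)
      τ≡3^[N∸v₀] = ≡.cong (3 ℕ.^_) (≡.trans (ℕₚ.∸-+-assoc n v₀ 1) (≡.cong (n ∸_) (ℕₚ.+-comm v₀ 1)))

      to-τ : ∀ {x} → 3^ (N ∸ v₀) ∣ x → ⟨ τ ⟩ ∣ x
      to-τ {x} = ≡.subst (λ t → ⟨ t ⟩ ∣ x) (≡.sym τ≡3^[N∸v₀])

      from-τ : ∀ {x} → ⟨ τ ⟩ ∣ x → 3^ (N ∸ v₀) ∣ x
      from-τ {x} = ≡.subst (λ t → ⟨ t ⟩ ∣ x) τ≡3^[N∸v₀]

      2v₀≡v₀+v₀ : 2 ℕ.* v₀ ≡ v₀ ℕ.+ v₀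
      2v₀≡v₀+v₀ = ≡.cong (v₀ ℕ.+_) (ℕₚ.+-identityʳ v₀)

      open Expansion q (proj₁ q≡1) (≈-trans (proj₂ q≡1) (+-congʳ (≈-sym 1-homo))) using (9∣q-c⇒; fixedPointEquation)

      module Cases (3∤u : ⟨ 3 ⟩ ∤ proj₁ q≡1) = FixedPoints
        (fixedPointEquation 3∤u f continuous interpolates N) 1≤N z₀ v₀ fixed valuation nonzero minimal

    fixedPoints-7 : ⟨ 9 ⟩ ∣ q - ⟨ 7 ⟩ →
      ( 2 ℕ.* v₀ < N → Fixed f n ≐ Coset z₀ τ ∪ Multiples τ ∪ Coset 1# (3 ℕ.^ N) )
      × ( N ≤ 2 ℕ.* v₀ → Fixed f n ≐ Multiples (3 ℕ.^ ⌊ n /2⌋) ∪ Coset 1# (3 ℕ.^ N) )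
    fixedPoints-7 q≡7 =
        (λ lt → let lt′ = ≡.subst (_< N) 2v₀≡v₀+v₀ lt in
            Sum.map (∣⇒coset ∘ to-τ) (Sum.map (∣⇒multiple ∘ to-τ) ∣⇒coset₁) ∘ proj₁ (small lt′)
          , proj₂ (small lt′) ∘ Sum.map (from-τ ∘ coset⇒∣) (Sum.map (from-τ ∘ multiple⇒∣) coset₁⇒∣))
      , (λ ge → let ge′ = ≡.subst (N ≤_) 2v₀≡v₀+v₀ ge in
            Sum.map ∣⇒multiple ∣⇒coset₁ ∘ proj₁ (large ge′)
          , proj₂ (large ge′) ∘ Sum.map multiple⇒∣ coset₁⇒∣)
      where
      3∣u-2 = 9∣q-c⇒ ⟨ 2 ⟩ (solve 0 (⟪ 7 ⟫ := ⟪ 1 ⟫ :+ ⟪ 3 ⟫ :* ⟪ 2 ⟫) ≈-refl) q≡7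
      open Cases.Case7 (≡2⇒3∤ 3∣u-2) 3∣u-2

    fixedPoints-4 : ⟨ 9 ⟩ ∣ q - ⟨ 4 ⟩ →
      ( 2 ℕ.* v₀ < N → Fixed f n ≐ Coset z₀ τ ∪ Coset 1# τ ∪ Multiples (3 ℕ.^ N) )
      × ( N ≤ 2 ℕ.* v₀ → Fixed f n ≐ Coset 1# (3 ℕ.^ ⌊ n /2⌋) ∪ Multiples (3 ℕ.^ N) )
    fixedPoints-4 q≡4 =
        (λ lt → let lt′ = ≡.subst (_< N) 2v₀≡v₀+v₀ lt in
            Sum.map (∣⇒coset ∘ to-τ) (Sum.map (∣⇒coset₁ ∘ to-τ) ∣⇒multiple) ∘ proj₁ (small lt′)
          , proj₂ (small lt′) ∘ Sum.map (from-τ ∘ coset⇒∣) (Sum.map (from-τ ∘ coset₁⇒∣) multiple⇒∣))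
      , (λ ge → let ge′ = ≡.subst (N ≤_) 2v₀≡v₀+v₀ ge in
            Sum.map ∣⇒coset₁ ∣⇒multiple ∘ proj₁ (large ge′)
          , proj₂ (large ge′) ∘ Sum.map coset₁⇒∣ multiple⇒∣)
      where
      3∣u-1 = 9∣q-c⇒ ⟨ 1 ⟩ (solve 0 (⟪ 4 ⟫ := ⟪ 1 ⟫ :+ ⟪ 3 ⟫ :* ⟪ 1 ⟫) ≈-refl) q≡4
      open Cases.Case4 (≡1⇒3∤ 3∣u-1) 3∣u-1

-- The inverse limit as an instance of the abstract ring

open import Defs

module ℤ₃-Arithmetic where

  ⟦_⟧ : ℤ → ℤ₃
  ⟦_⟧ = integer ℤ₃-commutativeRing ⟨_⟩

  approx-⟦⟧ : ∀ a n → approx ⟦ a ⟧ n ≡ a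
  approx-⟦⟧ (+ n)    _ = ≡.refl
  approx-⟦⟧ -[1+ n ] _ = ≡.refl

  pointwise : ∀ {x y} → (∀ n → approx x n ≡ approx y n) → x ≈ y
  pointwise {x} {y} e = mk≈ λ n → divides (+ 0)
    (≡.trans (≡.cong (ℤ._- approx y n) (e n)) (ℤₚ.+-inverseʳ (approx y n)))

  ⟦⟧-+ : ∀ a b → ⟦ a ℤ.+ b ⟧ ≈ ⟦ a ⟧ + ⟦ b ⟧
  ⟦⟧-+ a b = pointwise λ n → ≡.trans (approx-⟦⟧ (a ℤ.+ b) n)
    (≡.sym (≡.cong₂ ℤ._+_ (approx-⟦⟧ a n) (approx-⟦⟧ b n)))

  ⟦⟧-* : ∀ a b → ⟦ a ℤ.* b ⟧ ≈ ⟦ a ⟧ * ⟦ b ⟧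
  ⟦⟧-* a b = pointwise λ n → ≡.trans (approx-⟦⟧ (a ℤ.* b) n)
    (≡.sym (≡.cong₂ ℤ._*_ (approx-⟦⟧ a n) (approx-⟦⟧ b n)))

  ⟦⟧-‿- : ∀ a → ⟦ ℤ.- a ⟧ ≈ - ⟦ a ⟧
  ⟦⟧-‿- a = pointwise λ n → ≡.trans (approx-⟦⟧ (ℤ.- a) n)
    (≡.sym (≡.cong ℤ.-_ (approx-⟦⟧ a n)))

  3*3^∣ : ∀ n {a} → + (3 ^ℕ suc n) ∣ℤ + 3 ℤ.* a → + (3 ^ℕ n) ∣ℤ a
  3*3^∣ n d = ℤ∣.*-cancelˡ-∣ (+ 3) (≡.subst (_∣ℤ _) (ℤₚ.pos-* 3 (3 ^ℕ n)) d)

  -- Division by 3 costs one digit, so the hypothesis is read at level n + 1 and `compat` leads back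
  -- to level n.
  3-cancelˡ : ∀ x y → ⟨ 3 ⟩ * x ≈ ⟨ 3 ⟩ * y → x ≈ y
  3-cancelˡ x y p = mk≈ λ n → ≡.subst (+ (3 ^ℕ n) ∣ℤ_)
    (telescope (approx x (suc n)) (approx x n) (approx y (suc n)) (approx y n))
    (ℤ∣.∣m∣n⇒∣m-n (ℤ∣.∣m∣n⇒∣m+n
      (3*3^∣ n (≡.subst (+ (3 ^ℕ suc n) ∣ℤ_) (factor (approx x (suc n)) (approx y (suc n))) (at p (suc n))))
      (compat y n)) (compat x n))
    where
    factor : ∀ a b → + 3 ℤ.* a ℤ.- + 3 ℤ.* b ≡ + 3 ℤ.* (a ℤ.- b)
    factor = ℤSolver.solve-∀
    telescope : ∀ a b c d → (a ℤ.- c) ℤ.+ (c ℤ.- d) ℤ.- (a ℤ.- b) ≡ b ℤ.- d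
    telescope = ℤSolver.solve-∀

  3∤1 : ⟨ 3 ⟩ ∤ ⟨ 1 ⟩
  3∤1 (w , p) = contradiction (ℕ∣.∣1⇒≡1 (ℤ∣.∣⇒∣ᵤ
    (≡.subst (+ 3 ∣ℤ_) (cancel (approx w 1 ℤ.* + 3)) (ℤ∣.∣m∣n⇒∣m-n (divides (approx w 1) ≡.refl) (at p 1))))) λ ()
    where
    cancel : ∀ a → a ℤ.- (a ℤ.- + 1) ≡ + 1
    cancel = ℤSolver.solve-∀

  3∣approx⇒3∣ : ∀ x → + 3 ∣ℤ approx x 1 → ⟨ 3 ⟩ ∣ x
  3∣approx⇒3∣ x 3∣x₁ = x/3 , mk≈ λ n →
      ≡.subst (λ a → + (3 ^ℕ n) ∣ℤ a ℤ.- approx x n) (third*3 n) (compat x n)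
    where
    3∣3^suc : ∀ n → + 3 ∣ℤ + (3 ^ℕ suc n)
    3∣3^suc n = divides (+ (3 ^ℕ n)) (≡.trans (ℤₚ.pos-* 3 (3 ^ℕ n)) (ℤₚ.*-comm (+ 3) (+ (3 ^ℕ n))))

    3∣ : ∀ n → + 3 ∣ℤ approx x (suc n)
    3∣ zero    = 3∣x₁
    3∣ (suc n) = ≡.subst (+ 3 ∣ℤ_) (cancel (approx x (2 ℕ.+ n)) (approx x (suc n)))
      (ℤ∣.∣m∣n⇒∣m+n (ℤ∣.∣-trans (3∣3^suc n) (compat x (suc n))) (3∣ n))
      where
      cancel : ∀ a b → a ℤ.- b ℤ.+ b ≡ a
      cancel = ℤSolver.solve-∀

    -- The n-th approximation of x/3 is a third of the (n + 1)-th approximation of x, which makes up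
    -- for the lost digit.
    third : ℕ → ℤ
    third n = ℤ∣.quotient (3∣ n)

    third*3 : ∀ n → approx x (suc n) ≡ third n ℤ.* + 3
    third*3 n = ℤ∣._∣_.equality (3∣ n)

    x/3 : ℤ₃
    x/3 = mkℤ₃ third λ n → 3*3^∣ n (≡.subst (+ (3 ^ℕ suc n) ∣ℤ_)
      (≡.trans (≡.cong₂ ℤ._-_ (third*3 (suc n)) (third*3 n)) (factor (third (suc n)) (third n)))
      (compat x (suc n)))
      where
      factor : ∀ a b → a ℤ.* + 3 ℤ.- b ℤ.* + 3 ≡ + 3 ℤ.* (a ℤ.- b)
      factor = ℤSolver.solve-∀

  residue : ∀ x → ⟨ 3 ⟩ ∣ x ⊎ ⟨ 3 ⟩ ∣ x - ⟨ 1 ⟩ ⊎ ⟨ 3 ⟩ ∣ x + ⟨ 1 ⟩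
  residue x = split (approx x 1 %ℕ 3) (n%ℕd<d (approx x 1) 3) (a≡a%ℕn+[a/ℕn]*n (approx x 1) 3)
    where
    c : ℤ
    c = approx x 1 /ℕ 3

    split : ∀ r → r < 3 → approx x 1 ≡ + r ℤ.+ c ℤ.* + 3 →
      ⟨ 3 ⟩ ∣ x ⊎ ⟨ 3 ⟩ ∣ x - ⟨ 1 ⟩ ⊎ ⟨ 3 ⟩ ∣ x + ⟨ 1 ⟩
    split 0 _ e = inj₁ (3∣approx⇒3∣ x (divides c (≡.trans e (ℤₚ.+-identityˡ _))))
    split 1 _ e = inj₂ (inj₁ (3∣approx⇒3∣ (x - ⟨ 1 ⟩)
      (divides c (≡.trans (≡.cong (ℤ._- + 1) e) (cancel (c ℤ.* + 3))))))
      where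
      cancel : ∀ a → + 1 ℤ.+ a ℤ.- + 1 ≡ a
      cancel = ℤSolver.solve-∀
    split 2 _ e = inj₂ (inj₂ (3∣approx⇒3∣ (x + ⟨ 1 ⟩)
      (divides (c ℤ.+ + 1) (≡.trans (≡.cong (ℤ._+ + 1) e) (regroup c)))))
      where
      regroup : ∀ c → + 2 ℤ.+ c ℤ.* + 3 ℤ.+ + 1 ≡ (c ℤ.+ + 1) ℤ.* + 3
      regroup = ℤSolver.solve-∀
    split (suc (suc (suc r))) (s≤s (s≤s (s≤s ()))) _

  is3AdicRing : Is3AdicRing ℤ₃-commutativeRing ⟨_⟩
  is3AdicRing = record
    { +-homo    = ⟦⟧-+
    ; *-homo    = ⟦⟧-*
    ; -‿homo    = ⟦⟧-‿-
    ; 0-homo    = pointwise λ _ → ≡.refl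
    ; 1-homo    = pointwise λ _ → ≡.refl
    ; 3-cancelˡ = 3-cancelˡ
    ; 3∤1       = 3∤1
    ; residue   = residue
    }

  open 3-AdicTheory ℤ₃-commutativeRing ⟨_⟩ is3AdicRing public
    using (fixedPoints-7; fixedPoints-4; HasVal-resp)

theorem5p8 : ∀ (n : ℕ) → 2 ≤ n →
    ∀ (q : ℤ₃) → q ∈ U⁽ 1 ⁾ → q ∉ U⁽ 2 ⁾ →
    ∀ (ι : ℤ₃ → ℤ₃) → IsIota q ι →
    ∀ (z₀ : ℤ₃) (v₀ : ℕ) → IsMinimalFixedPoint ι n z₀ v₀ →
    let τ = 3 ^ℕ (n ∸ v₀ ∸ 1) in
    ( q ≋ ⟨ 7 ⟩ [mod 9 ] →
    ( 2 *ℕ v₀ < n ∸ 1 →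
    IsModularFixedPoint ι n ≐
    (z₀ ⊹ τ ℤ₃) ∪ (τ ·ℤ₃) ∪ (1# ⊹ (3 ^ℕ (n ∸ 1)) ℤ₃) )
    × ( 2 *ℕ v₀ ≥ n ∸ 1 →
    IsModularFixedPoint ι n ≐
    ((3 ^ℕ ⌊ n /2⌋) ·ℤ₃) ∪ (1# ⊹ (3 ^ℕ (n ∸ 1)) ℤ₃) ) )
    ×
    ( q ≋ ⟨ 4 ⟩ [mod 9 ] →
    ( 2 *ℕ v₀ < n ∸ 1 →
    IsModularFixedPoint ι n ≐
    (z₀ ⊹ τ ℤ₃) ∪ (1# ⊹ τ ℤ₃) ∪ ((3 ^ℕ (n ∸ 1)) ·ℤ₃) )
    × ( 2 *ℕ v₀ ≥ n ∸ 1 →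
    IsModularFixedPoint ι n ≐
    (1# ⊹ (3 ^ℕ ⌊ n /2⌋) ℤ₃) ∪ ((3 ^ℕ (n ∸ 1)) ·ℤ₃) ) )
theorem5p8 (suc N) (s≤s 1≤N) q q≡1 _ ι isIota z₀ v₀ isMinimal =
    fixedPoints-7 q q≡1 ι continuous interpolates N 1≤N z₀ v₀ fixed
      -- This passes from `1#` to `⟨ 1 ⟩` by comparing approximations only.
      (HasVal-resp v₀ (pointwise λ _ → ≡.refl) valuation) nonzero
      (λ z m fx val → minimal z m fx (HasVal-resp m (pointwise λ _ → ≡.refl) val))
  , fixedPoints-4 q q≡1 ι continuous interpolates N 1≤N z₀ v₀ fixed
      (HasVal-resp v₀ (pointwise λ _ → ≡.refl) valuation) nonzero
      (λ z m fx val → minimal z m fx (HasVal-resp m (pointwise λ _ → ≡.refl) val))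
  where
  open ℤ₃-Arithmetic
  open IsIota isIota
  open IsMinimalFixedPoint isMinimal
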